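{- Let $r\geq 1$ be an integer. The pair of permutation statistics $(\mathsf{exc}_{r},\mathsf{den})$ is $r$-Euler--Mahonian; that is, for every positive integer $n$, $$\sum_{\sigma\in\mathfrak{S}_n} t^{\mathsf{exc}_r(\sigma)}q^{\mathsf{den}(\sigma)}=\sum_{\sigma\in\mathfrak{S}_n} t^{r\mathsf{des}(\sigma)}q^{r\mathsf{maj}(\sigma)}.$$
   Context: $\mathfrak{S}_n$ is the set of permutations of $[n]=\{1,\dots,n\}$, written in one-line notation $\sigma=\sigma_1\sigma_2\cdots\sigma_n$. For a word $u$ of distinct integers, $\mathsf{inv}(u)$ is the number of pairs of positions $i<j$ with $u_i>u_j$. A position $i$ is an excedance of $\sigma$ if $\sigma_i>i$; $\mathsf{Exc}(\sigma)$ is the set of excedances. $\mathsf{exc}_r(\sigma)=|\{i\in[n]:\sigma_i>i,\ i\geq r\}|$ (number of $r$-level excedances). Denert's statistic: let $\mathrm{EXCL}(\sigma)$ be the subsequence of $\sigma$ consisting of the letters $\sigma_i$ with $i\in\mathsf{Exc}(\sigma)$, and $\mathrm{NEXCL}(\sigma)$ the subsequence of the remaining letters; then $\mathsf{den}(\sigma)=\sum_{i\in\mathsf{Exc}(\sigma)} i+\mathsf{inv}(\mathrm{EXCL}(\sigma))+\mathsf{inv}(\mathrm{NEXCL}(\sigma))$. $r$-descents: $r\mathsf{Des}(\sigma)=\{i\in[n-1]:\sigma_i\geq\sigma_{i+1}+r\}$, $r\mathsf{des}(\sigma)=|r\mathsf{Des}(\sigma)|$. $r$-major index: $r\mathsf{maj}(\sigma)=\sum_{i\in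 r\mathsf{Des}(\sigma)} i+|\{(i,j):i<j,\ \sigma_i>\sigma_j,\ \sigma_i<\sigma_j+r\}|$. A pair of permutation statistics is called $r$-Euler--Mahonian if for every $n\geq1$ its joint distribution over $\mathfrak{S}_n$ equals that of $(r\mathsf{des},r\mathsf{maj})$. -}

module Defs where

open import Data.Nat using (ℕ; zero; suc; _+_; _∸_; _<_; _≤_; _<?_; _≤?_)
import Data.Nat.Properties as ℕP
open import Data.List using (List; []; _∷_; map; filter; length; concatMap; upTo; zip; drop)
open import Data.Nat.ListAction using (sum)
open import Data.Product using (_×_; _,_; proj₁; proj₂)
open import Relation.Nullary using (¬_)
open import Relation.Nullary.Decidable using (_×-dec_; ¬?)
open import Data.List.Relation.Unary.Unique.Propositional using (Unique)
open import Data.List.Relation.Unary.Unique.DecPropositional ℕP._≟_ using (unique?)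

range : ℕ → List ℕ
range n = map suc (upTo n)

words : ℕ → ℕ → List (List ℕ)
words zero    n = [] ∷ []
words (suc k) n = concatMap (λ x → map (x ∷_) (words k n)) (range n)

-- 𝔖ₙ : permutations of [n] in one-line notation
-- (words of length n over [n] with pairwise distinct letters)
Sn : ℕ → List (List ℕ)
Sn n = filter unique? (words n n)

inv : List ℕ → ℕ
inv []       = 0
inv (x ∷ xs) = length (filter (λ y → y <? x) xs) + inv xs

-- positioned letters (i , σ_i), positions 1-based
pos : List ℕ → List (ℕ × ℕ)
pos σ = zip (range (length σ)) σ

isExc : ℕ × ℕ → Set
isExc (i , v) = i < v

exc : ℕ → List ℕ → ℕ
exc r σ = length (filter (λ p → (proj₁ p <? proj₂ p) ×-dec (r ≤? proj₁ p)) (pos σ))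

den : List ℕ → ℕ
den σ = sum (map proj₁ E) + inv (map proj₂ E) + inv (map proj₂ N)
  where
  E = filter (λ p → proj₁ p <? proj₂ p) (pos σ)
  N = filter (λ p → ¬? (proj₁ p <? proj₂ p)) (pos σ)

rDes : ℕ → List ℕ → List ℕ
rDes r σ = map (λ t → proj₁ t) (filter (λ t → (proj₂ (proj₂ t) + r) ≤? proj₁ (proj₂ t))
                (zip (range (length σ)) (zip σ (drop 1 σ))))

rdes : ℕ → List ℕ → ℕ
rdes r σ = length (rDes r σ)

smallInv : ℕ → List ℕ → ℕ
smallInv r []       = 0
smallInv r (x ∷ xs) = length (filter (λ y → (y <? x) ×-dec (x <? y + r)) xs) + smallInv r xs

rmaj : ℕ → List ℕ → ℕ
rmaj r σ = sum (rDes r σ) + smallInv r σ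

jointCount : (List ℕ → ℕ) → (List ℕ → ℕ) → ℕ → ℕ → ℕ → ℕ
jointCount f g n a b = length (filter (λ σ → (f σ ℕP.≟ a) ×-dec (g σ ℕP.≟ b)) (Sn n))

{-# OPTIONS --safe #-}

-- Both sides satisfy the same recursion for the sums of φ (first statistic) * q ^ (second
-- statistic), φ : ℕ → ℕ arbitrary; for q > |𝔖ₙ| these sums determine the joint distribution.
--
-- For (rdes, rmaj), r = 1 + s, insert the largest letter n + 1 into a permutation of [n], n ≥ s,
-- with k r-descents: s + k + 1 places keep k and raise rmaj by 0, …, s + k; the other places give k + 1
-- r-descents and raise rmaj by s + k + 1, …, n.
--
-- For (exc_r, den), den is the sum over j of the number of letters before position j in the
-- cyclic interval ]σ_j, j]. Reading σ from its last letter to its first, the letters still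
-- available at position j matter only through the set w of those that are ≤ j, which gives a
-- recursion on w with values H w. An insertion-like recursion for H comes from the commutation
-- of the operators Ψ h, where Ψ h ψ m = [m] ψ (m - 1) + q ^ m [h - m] ψ m.

module Submission where

open import Defs
open import Data.Bool using (Bool; true; false; if_then_else_)
open import Data.List
  using (List; []; _∷_; _++_; [_]; map; length; filter; reverse; _∷ʳ_; concatMap; upTo; applyUpTo
        ; zip; drop)
open import Data.List.Membership.Propositional using (_∈_)
open import Data.List.Properties
  using (unfold-reverse; length-++; ++-identityʳ; ++-assoc; upTo-∷ʳ; map-++; map-∘; map-upTo
        ; filter-++; filter-accept; filter-reject; length-reverse; length-map; length-upTo)
open import Data.List.Relation.Binary.Permutation.Propositional
  using (_↭_; ↭-sym; ↭-trans; ↭-refl; ↭-reflexive; prep; swap; ↭⇒↭ₛ)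
open import Data.List.Relation.Binary.Permutation.Propositional.Properties
  using (↭-length; map⁺; shift; All-resp-↭; ∷↭∷ʳ)
open import Data.List.Relation.Binary.Permutation.Setoid.Properties using (Unique-resp-↭)
open import Data.List.Relation.Unary.All as All using (All; []; _∷_)
import Data.List.Relation.Unary.All.Properties as AllP
open import Data.List.Relation.Unary.AllPairs using (AllPairs; []; _∷_)
import Data.List.Relation.Unary.AllPairs.Properties as AllPairsP
open import Data.List.Relation.Unary.Any using (here; there)
open import Data.List.Relation.Unary.Unique.Propositional using (Unique)
open import Data.Nat
  using (ℕ; zero; suc; pred; _+_; _*_; _∸_; _^_; _<_; _>_; _≤_; _<?_; _≤?_; z≤n; s≤s)
open import Data.Nat.DivMod using (_%_; m<n⇒m%n≡m; [m+kn]%n≡m%n)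
open import Data.Nat.ListAction using (sum)
open import Data.Nat.ListAction.Properties using (sum-↭)
import Data.Nat.Properties as ℕP
open import Data.List.Relation.Unary.Unique.DecPropositional ℕP._≟_ using (unique?)
open import Data.Nat.Tactic.RingSolver using (solve-∀)
open import Data.Product using (Σ; _×_; _,_; proj₁; proj₂)
open import Data.Sum using (_⊎_; inj₁; inj₂)
open import Data.Vec using (Vec; []; _∷_; replicate)
open import Relation.Binary.PropositionalEquality hiding ([_])
open import Relation.Nullary using (Dec; yes; no; does; ¬_; contradiction)
open import Relation.Nullary.Decidable using (_×-dec_; ¬?)
open import Relation.Unary using (Decidable)
open ≡-Reasoning

-- q-numbers and the commuting operators Ψ

-- The backward reading forces a recursion through every set w, while insertion only ever sees the
-- full one. `H` is therefore defined from the insertion side: each letter above s, from the top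
-- down, applies one `Ψ`, and an absent letter merely leaves the argument unshifted. For the full
-- set this is the insertion recursion for `(rdes, rmaj)` as it stands; the work goes into `H-rec`,
-- by which the same `H` obeys the backward recursion. The argument m of ψ is k + s minus the number
-- of available letters beyond the current position, where k counts the excedances of level r still
-- to come. All those letters become excedances, and at most s of them escape being counted, at the
-- positions up to s; so m is never negative. For the full set m = s + k, and the two groups of
-- insertion places are the two terms of `Ψ (n + 1) ψ (m + 1)`. An arbitrary weight φ is carried
-- along because prepending a letter or passing an excedance changes the weight, and the induction
-- hypothesis is then applied to the new one.

bit : Bool → ℕ
bit false = 0
bit true  = 1

ones : ∀ {j} → Vec Bool j → ℕ
ones []      = 0
ones (b ∷ w) = bit b + ones w

ones≤ : ∀ {j} (w : Vec Bool j) → ones w ≤ j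
ones≤ []          = z≤n
ones≤ (false ∷ w) = ℕP.m≤n⇒m≤1+n (ones≤ w)
ones≤ (true ∷ w)  = s≤s (ones≤ w)

module _ (q : ℕ) where

  qnum : ℕ → ℕ
  qnum zero    = 0
  qnum (suc m) = 1 + q * qnum m

  qnum-+ : ∀ m x → qnum (m + x) ≡ qnum m + q ^ m * qnum x
  qnum-+ zero    x = sym (ℕP.+-identityʳ (qnum x))
  qnum-+ (suc m) x = trans (cong (λ t → 1 + q * t) (qnum-+ m x)) (lem q (qnum m) (q ^ m) (qnum x))
    where
    lem : ∀ q a b c → 1 + q * (a + b * c) ≡ 1 + q * a + q * b * c
    lem = solve-∀

  qnum-suc : ∀ m → qnum (suc m) ≡ qnum m + q ^ m
  qnum-suc m = trans (cong qnum (ℕP.+-comm 1 m))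
    (trans (qnum-+ m 1) (cong (qnum m +_) (lem q (q ^ m))))
    where
    lem : ∀ q b → b * (1 + q * 0) ≡ b
    lem = solve-∀

  qfac : ℕ → ℕ
  qfac zero    = 1
  qfac (suc m) = qnum (suc m) * qfac m

  Ψ : ℕ → (ℕ → ℕ) → ℕ → ℕ
  Ψ h ψ m = qnum m * ψ (pred m) + q ^ m * qnum (h ∸ m) * ψ m

  -- Only the coefficient of ψ (m - 1) seems to depend on the order. It is q ^ (m - 1) [m]
  -- ([j - m + 1] + q [h - m]), and [j - m + 1] = 1 + q [j - m] makes it symmetric in h and j. The
  -- bounds on m keep the subtractions from being truncated.
  Ψ-comm : ∀ h j ψ m → m ≤ h → m ≤ j → Ψ h (Ψ j ψ) m ≡ Ψ j (Ψ h ψ) m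
  Ψ-comm h j ψ zero _ _ = lem (qnum h) (qnum j) (ψ 0)
    where
    lem : ∀ a b c → (0 + 0) + 1 * a * (0 + 1 * b * c) ≡ (0 + 0) + 1 * b * (0 + 1 * a * c)
    lem = solve-∀
  Ψ-comm h j ψ (suc m) m<h m<j
    with ℕP.m≤n⇒∃[o]m+o≡n m<h | ℕP.m≤n⇒∃[o]m+o≡n m<j
  ... | x , refl | y , refl
    rewrite ℕP.m+n∸m≡n m x | ℕP.m+n∸m≡n m y
          | sym (ℕP.+-suc m x) | ℕP.m+n∸m≡n m (suc x)
          | sym (ℕP.+-suc m y) | ℕP.m+n∸m≡n m (suc y)
    = lem q (qnum m) (q ^ m) (qnum x) (qnum y) (ψ (pred m)) (ψ m) (ψ (suc m))
    where
    lem : ∀ q M Q X Y a b c →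
      (1 + q * M) * (M * a + Q * (1 + q * Y) * b) + q * Q * X * ((1 + q * M) * b + q * Q * Y * c)
      ≡ (1 + q * M) * (M * a + Q * (1 + q * X) * b) + q * Q * Y * ((1 + q * M) * b + q * Q * X * c)
    lem = solve-∀

  Ψ-cong : ∀ h {ψ ψ'} m → (∀ k → k ≤ m → ψ k ≡ ψ' k) → Ψ h ψ m ≡ Ψ h ψ' m
  Ψ-cong h m eq = cong₂ (λ a b → qnum m * a + q ^ m * qnum (h ∸ m) * b)
    (eq (pred m) ℕP.pred[n]≤n) (eq m ℕP.≤-refl)

  -- The sum over all deletions of one present letter, weighted by q to the number of larger letters
  -- present.
  S : ∀ {j} → (Vec Bool j → ℕ) → Vec Bool j → ℕ
  S F []      = 0
  S F (b ∷ w) = bit b * F (false ∷ w) + q ^ bit b * S (λ v → F (b ∷ v)) w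

  S-cong : ∀ {j} {F G : Vec Bool j → ℕ} w →
    (∀ v → suc (ones v) ≡ ones w → F v ≡ G v) → S F w ≡ S G w
  S-cong []          eq = refl
  S-cong (false ∷ w) eq = cong (1 *_) (S-cong w λ v e → eq (false ∷ v) e)
  S-cong (true ∷ w)  eq = cong₂ (λ a b → 1 * a + q ^ 1 * b) (eq (false ∷ w) refl)
    (S-cong w λ v e → eq (true ∷ v) (cong suc e))

  S-* : ∀ {j} c (F : Vec Bool j → ℕ) w → S (λ v → c * F v) w ≡ c * S F w
  S-* c F []      = sym (ℕP.*-zeroʳ c)
  S-* c F (b ∷ w) = trans (cong (λ t → bit b * (c * F (false ∷ w)) + q ^ bit b * t)
      (S-* c (λ v → F (b ∷ v)) w))
      (lem c (bit b) (F (false ∷ w)) (q ^ bit b) (S (λ v → F (b ∷ v)) w))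
    where
    lem : ∀ c x y z s → x * (c * y) + z * (c * s) ≡ c * (x * y + z * s)
    lem = solve-∀

  S-ones : ∀ {j} (g : ℕ → ℕ) (w : Vec Bool j) →
    S (λ v → g (ones v)) w ≡ qnum (ones w) * g (pred (ones w))
  S-ones g []          = refl
  S-ones g (false ∷ w) = trans (ℕP.*-identityˡ _) (S-ones g w)
  S-ones g (true ∷ w)  = trans (cong (λ t → 1 * g (ones w) + q ^ 1 * t) (S-ones (λ k → g (suc k)) w))
      (lem (ones w))
    where
    lem' : ∀ q a b → 1 * a + q * 1 * (b * a) ≡ (1 + q * b) * a
    lem' = solve-∀
    lem : ∀ h → 1 * g h + q ^ 1 * (qnum h * g (suc (pred h))) ≡ qnum (suc h) * g h
    lem zero    = lem' q (g 0) 0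
    lem (suc h) = lem' q (g (suc h)) (qnum (suc h))

  module _ (s : ℕ) where

    -- In the base case only positions up to s are left, where no excedance is counted: they
    -- contribute the factor [s]!, and k = 0 makes the argument `ones w`.
    H : ∀ i → Vec Bool (i + s) → (ℕ → ℕ) → ℕ
    H zero    w       ψ = qfac s * ψ (ones w)
    H (suc i) (b ∷ w) ψ = H i w (λ m → Ψ (suc (i + s)) ψ (bit b + m))

    H-cong : ∀ i w {ψ ψ'} → (∀ m → m ≤ ones w → ψ m ≡ ψ' m) → H i w ψ ≡ H i w ψ'
    H-cong zero    w       eq = cong (qfac s *_) (eq (ones w) ℕP.≤-refl)
    H-cong (suc i) (b ∷ w) eq = H-cong i w λ m m≤ → Ψ-cong (suc (i + s)) (bit b + m)
      λ k k≤ → eq k (ℕP.≤-trans k≤ (ℕP.+-monoʳ-≤ (bit b) m≤))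

    H-linear : ∀ i w a c ψ ψ' → H i w (λ m → a * ψ m + c * ψ' m) ≡ a * H i w ψ + c * H i w ψ'
    H-linear zero    w       a c ψ ψ' = lem (qfac s) a (ψ (ones w)) c (ψ' (ones w))
      where
      lem : ∀ f a x c y → f * (a * x + c * y) ≡ a * (f * x) + c * (f * y)
      lem = solve-∀
    H-linear (suc i) (b ∷ w) a c ψ ψ' = trans
      (H-cong i w λ m _ → lem (qnum (bit b + m)) a (ψ (pred (bit b + m))) c (ψ' (pred (bit b + m)))
        (q ^ (bit b + m) * qnum (suc (i + s) ∸ (bit b + m))) (ψ (bit b + m)) (ψ' (bit b + m)))
      (H-linear i w a c _ _)
      where
      lem : ∀ n a x c y p x' y' → n * (a * x + c * y) + p * (a * x' + c * y')
        ≡ a * (n * x + p * x') + c * (n * y + p * y')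
      lem = solve-∀

    -- A present top letter is either deleted at weight 1 or costs the other deletions a factor q; 1
    -- + q [m] = [m + 1] merges the two into one `Ψ` with both indices raised.
    Ψ-shift : ∀ h b ψ m → bit b * ψ m + q ^ bit b * Ψ h (λ k → ψ (bit b + k)) m
      ≡ Ψ (bit b + h) ψ (bit b + m)
    Ψ-shift h false ψ m = ℕP.*-identityˡ _
    Ψ-shift h true ψ zero = lem q (qnum h) (ψ 0) (ψ 1)
      where
      lem : ∀ q a c x → 1 * c + q * 1 * (0 + 1 * a * x) ≡ (1 + q * 0) * c + q * 1 * a * x
      lem = solve-∀
    Ψ-shift h true ψ (suc m) =
      lem q (qnum (h ∸ suc m)) (qnum (suc m)) (q ^ suc m) (ψ (suc m)) (ψ (suc (suc m)))
      where
      lem : ∀ q a n p c x → 1 * c + q * 1 * (n * c + p * a * x) ≡ (1 + q * n) * c + q * p * a * x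
      lem = solve-∀

    -- Deleting a letter is itself a `Ψ`, whose index is the number of letters present. In the
    -- induction `Ψ-shift` raises this index by the top letter, but the result stands on the wrong
    -- side of the `Ψ j` that `H` applies for that letter; commuting the two closes the step.
    S-H : ∀ i w ψ → S (λ v → H i v ψ) w ≡ H i w (Ψ (ones w) ψ)
    S-H zero w ψ = begin
      S (λ v → qfac s * ψ (ones v)) w ≡⟨ S-* (qfac s) (λ v → ψ (ones v)) w ⟩
      qfac s * S (λ v → ψ (ones v)) w ≡⟨ cong (qfac s *_) (S-ones ψ w) ⟩
      qfac s * (qnum h * ψ (pred h))  ≡⟨ lem (qfac s) (qnum h * ψ (pred h)) (q ^ h) (ψ h) ⟩
      qfac s * (qnum h * ψ (pred h) + q ^ h * 0 * ψ h)
        ≡⟨ cong (λ t → qfac s * (qnum h * ψ (pred h) + q ^ h * qnum t * ψ h)) (ℕP.n∸n≡0 h) ⟨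
      qfac s * Ψ h ψ h ∎
      where
      h = ones w
      lem : ∀ f a p b → f * a ≡ f * (a + p * 0 * b)
      lem = solve-∀
    S-H (suc i) (b ∷ w) ψ = begin
      bit b * H i w (Ψ j ψ) + q ^ bit b * S (λ v → H i v θ) w
        ≡⟨ cong (λ t → bit b * H i w (Ψ j ψ) + q ^ bit b * t) (S-H i w θ) ⟩
      bit b * H i w (Ψ j ψ) + q ^ bit b * H i w (Ψ h θ)
        ≡⟨ H-linear i w (bit b) (q ^ bit b) _ _ ⟨
      H i w (λ m → bit b * Ψ j ψ m + q ^ bit b * Ψ h θ m)
        ≡⟨ H-cong i w (λ m m≤ → trans (Ψ-shift h b (Ψ j ψ) m)
             (Ψ-comm (bit b + h) j ψ (bit b + m) (ℕP.+-monoʳ-≤ (bit b) m≤)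
               (ℕP.≤-trans (ℕP.+-monoʳ-≤ (bit b) m≤) (ones≤ (b ∷ w))))) ⟩
      H i w (λ m → Ψ j (Ψ (bit b + h) ψ) (bit b + m)) ∎
      where
      j = suc (i + s)
      h = ones w
      θ : ℕ → ℕ
      θ m = Ψ j ψ (bit b + m)

    -- This is q ^ m [h - m] + q ^ h [j - h] = q ^ m [j - m]. The part split off belongs to the j -
    -- h available letters beyond position j.
    Ψ-split : ∀ j h ψ m → m ≤ h → h ≤ j →
      q ^ h * qnum (j ∸ h) * ψ m + Ψ h ψ m ≡ Ψ j ψ m
    Ψ-split j h ψ m m≤h h≤j with ℕP.m≤n⇒∃[o]m+o≡n m≤h
    ... | x , refl with ℕP.m≤n⇒∃[o]m+o≡n h≤j
    ... | y , refl = begin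
      q ^ (m + x) * qnum (m + x + y ∸ (m + x)) * c + (a + q ^ m * qnum (m + x ∸ m) * c)
        ≡⟨ cong₂ (λ u v → q ^ (m + x) * qnum u * c + (a + q ^ m * qnum v * c))
             (ℕP.m+n∸m≡n (m + x) y) (ℕP.m+n∸m≡n m x) ⟩
      q ^ (m + x) * qnum y * c + (a + q ^ m * qnum x * c)
        ≡⟨ cong (λ u → u * qnum y * c + (a + q ^ m * qnum x * c)) (ℕP.^-distribˡ-+-* q m x) ⟩
      q ^ m * q ^ x * qnum y * c + (a + q ^ m * qnum x * c)
        ≡⟨ lem (q ^ m) (q ^ x) (qnum y) c a (qnum x) ⟩
      a + q ^ m * (qnum x + q ^ x * qnum y) * c
        ≡⟨ cong (λ u → a + q ^ m * u * c) (qnum-+ x y) ⟨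
      a + q ^ m * qnum (x + y) * c
        ≡⟨ cong (λ u → a + q ^ m * qnum u * c)
             (trans (cong (_∸ m) (ℕP.+-assoc m x y)) (ℕP.m+n∸m≡n m (x + y))) ⟨
      a + q ^ m * qnum (m + x + y ∸ m) * c ∎
      where
      c = ψ m
      a = qnum m * ψ (pred m)
      lem : ∀ p p' y c a x → p * p' * y * c + (a + p * x * c) ≡ a + p * (x + p' * y) * c
      lem = solve-∀

    -- The three terms on the right are the choices at position suc (i + s) in the backward reading:
    -- a letter beyond the position, the letter equal to it, a smaller one. `Ψ-split` separates the
    -- first from the single `Ψ j` in `H`, `Ψ-shift` the second, and `S-H` turns the remaining
    -- `Ψ (ones w)` into deletions.
    H-rec : ∀ i b w ψ → H (suc i) (b ∷ w) ψ ≡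
        q ^ (bit b + ones w) * qnum (suc (i + s) ∸ (bit b + ones w)) * H i w (λ m → ψ (bit b + m))
        + (bit b * H i w ψ + q ^ bit b * S (λ v → H i v (λ m → ψ (bit b + m))) w)
    H-rec i b w ψ = begin
      H i w (λ m → Ψ j ψ (bit b + m))
        ≡⟨ H-cong i w (λ m m≤ → sym (trans
             (cong (coef * ψ (bit b + m) +_) (Ψ-shift h b ψ m))
             (Ψ-split j (bit b + h) ψ (bit b + m) (ℕP.+-monoʳ-≤ (bit b) m≤) (ones≤ (b ∷ w))))) ⟩
      H i w (λ m → coef * θ m + (bit b * ψ m + q ^ bit b * Ψ h θ m))
        ≡⟨ H-cong i w (λ m _ → cong (coef * θ m +_) (sym (ℕP.*-identityˡ _))) ⟩
      H i w (λ m → coef * θ m + 1 * (bit b * ψ m + q ^ bit b * Ψ h θ m))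
        ≡⟨ H-linear i w coef 1 _ _ ⟩
      coef * H i w θ + 1 * H i w (λ m → bit b * ψ m + q ^ bit b * Ψ h θ m)
        ≡⟨ cong (coef * H i w θ +_) (trans (ℕP.*-identityˡ _) (H-linear i w (bit b) (q ^ bit b) _ _)) ⟩
      coef * H i w θ + (bit b * H i w ψ + q ^ bit b * H i w (Ψ h θ))
        ≡⟨ cong (λ t → coef * H i w θ + (bit b * H i w ψ + q ^ bit b * t)) (S-H i w θ) ⟨
      coef * H i w θ + (bit b * H i w ψ + q ^ bit b * S (λ v → H i v θ) w) ∎
      where
      j = suc (i + s)
      h = ones w
      coef = q ^ (bit b + h) * qnum (j ∸ (bit b + h))
      θ : ℕ → ℕ
      θ m = ψ (bit b + m)

-- Sums over arrangements

∑ : ∀ {A : Set} → (A → ℕ) → List A → ℕ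
∑ f xs = sum (map f xs)

∑-++ : ∀ {A : Set} (f : A → ℕ) xs ys → ∑ f (xs ++ ys) ≡ ∑ f xs + ∑ f ys
∑-++ f []       ys = refl
∑-++ f (x ∷ xs) ys = trans (cong (f x +_) (∑-++ f xs ys)) (sym (ℕP.+-assoc (f x) _ _))

∑-↭ : ∀ {A : Set} (f : A → ℕ) {xs ys} → xs ↭ ys → ∑ f xs ≡ ∑ f ys
∑-↭ f p = sum-↭ (map⁺ f p)

interchange : ∀ a b c d → (a + b) + (c + d) ≡ (a + c) + (b + d)
interchange = solve-∀

∑-+ : ∀ {A : Set} (f g : A → ℕ) xs → ∑ (λ x → f x + g x) xs ≡ ∑ f xs + ∑ g xs
∑-+ f g []       = refl
∑-+ f g (x ∷ xs) = trans (cong (f x + g x +_) (∑-+ f g xs)) (interchange (f x) (g x) _ _)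

∑-cong : ∀ {A : Set} {f g : A → ℕ} xs → (∀ x → f x ≡ g x) → ∑ f xs ≡ ∑ g xs
∑-cong []       eq = refl
∑-cong (x ∷ xs) eq = cong₂ _+_ (eq x) (∑-cong xs eq)

-- The remainder keeps the order of the list. Hence a descending list stays descending, and the
-- available letters can always be written literally as high letters followed by `low w`.
sel : List ℕ → (ℕ → List ℕ → ℕ) → ℕ
sel []       f = 0
sel (x ∷ xs) f = f x xs + sel xs (λ y r → f y (x ∷ r))

sel-cong : ∀ A {f g} → (∀ x r → A ↭ x ∷ r → f x r ≡ g x r) → sel A f ≡ sel A g
sel-cong []      eq = refl
sel-cong (x ∷ A) eq = cong₂ _+_ (eq x A ↭-refl)
  (sel-cong A λ y r p → eq y (x ∷ r) (↭-trans (prep x p) (swap x y ↭-refl)))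

sel-+ : ∀ A f g → sel A (λ x r → f x r + g x r) ≡ sel A f + sel A g
sel-+ []      f g = refl
sel-+ (x ∷ A) f g = trans (cong (f x A + g x A +_) (sel-+ A _ _)) (interchange (f x A) (g x A) _ _)

sel-* : ∀ A c f → sel A (λ x r → c * f x r) ≡ c * sel A f
sel-* []      c f = sym (ℕP.*-zeroʳ c)
sel-* (x ∷ A) c f = trans (cong (c * f x A +_) (sel-* A c _)) (sym (ℕP.*-distribˡ-+ c (f x A) _))

sel-++ : ∀ xs ys f → sel (xs ++ ys) f ≡ sel xs (λ x r → f x (r ++ ys)) + sel ys (λ y r → f y (xs ++ r))
sel-++ []       ys f = refl
sel-++ (x ∷ xs) ys f = trans (cong (f x (xs ++ ys) +_) (sel-++ xs ys _)) (sym (ℕP.+-assoc (f x (xs ++ ys)) _ _))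

∑≡sel : ∀ f A → ∑ f A ≡ sel A (λ x _ → f x)
∑≡sel f []      = refl
∑≡sel f (x ∷ A) = cong (f x +_) (∑≡sel f A)

arr : ℕ → List ℕ → (List ℕ → ℕ) → ℕ
arr zero    A F = F []
arr (suc k) A F = sel A (λ x r → arr k r (λ w → F (x ∷ w)))

arr-cong : ∀ k A {F G} → length A ≡ k → (∀ w → w ↭ A → F w ≡ G w) → arr k A F ≡ arr k A G
arr-cong zero    []      l eq = eq [] ↭-refl
arr-cong (suc k) A       l eq = sel-cong A λ x r p →
  arr-cong k r (ℕP.suc-injective (trans (sym (↭-length p)) l))
    λ w w↭ → eq (x ∷ w) (↭-trans (prep x w↭) (↭-sym p))

arr-ext : ∀ k A {F G} → (∀ w → F w ≡ G w) → arr k A F ≡ arr k A G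
arr-ext zero    A eq = eq []
arr-ext (suc k) A eq = sel-cong A λ x r p → arr-ext k r λ w → eq (x ∷ w)

arr-+ : ∀ k A F G → arr k A (λ w → F w + G w) ≡ arr k A F + arr k A G
arr-+ zero    A F G = refl
arr-+ (suc k) A F G = trans (sel-cong A λ x r p → arr-+ k r _ _) (sel-+ A _ _)

arr-* : ∀ k A c F → arr k A (λ w → c * F w) ≡ c * arr k A F
arr-* zero    A c F = refl
arr-* (suc k) A c F = trans (sel-cong A λ x r p → arr-* k r c _) (sel-* A c _)

ins : ℕ → List ℕ → (List ℕ → ℕ) → ℕ
ins a []      F = F [ a ]
ins a (x ∷ w) F = F (a ∷ x ∷ w) + ins a w (λ v → F (x ∷ v))

-- The first letter is `a` or some y of `A`; in the second case the induction inserts `a` behind y.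
arr-ins : ∀ k a A F → length A ≡ k → arr (suc k) (a ∷ A) F ≡ arr k A (λ w → ins a w F)
arr-ins zero    a []    F l = ℕP.+-identityʳ _
arr-ins (suc k) a A F l = begin
  sel A (λ y r → arr k r (λ w → F (a ∷ y ∷ w))) + sel A (λ y r → arr (suc k) (a ∷ r) (λ w → F (y ∷ w)))
    ≡⟨ cong (sel A (λ y r → arr k r (λ w → F (a ∷ y ∷ w))) +_)
         (sel-cong A λ y r p → arr-ins k a r _ (ℕP.suc-injective (trans (sym (↭-length p)) l))) ⟩
  sel A (λ y r → arr k r (λ w → F (a ∷ y ∷ w))) + sel A (λ y r → arr k r (λ w → ins a w (λ v → F (y ∷ v))))
    ≡⟨ sel-+ A _ _ ⟨
  sel A (λ y r → arr k r (λ w → F (a ∷ y ∷ w)) + arr k r (λ w → ins a w (λ v → F (y ∷ v))))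
    ≡⟨ sel-cong A (λ y r p → sym (arr-+ k r _ _)) ⟩
  arr (suc k) A (λ w → ins a w F) ∎

ins-ext : ∀ a w {F G} → (∀ v → F v ≡ G v) → ins a w F ≡ ins a w G
ins-ext a []      eq = eq [ a ]
ins-ext a (x ∷ w) eq = cong₂ _+_ (eq _) (ins-ext a w λ v → eq (x ∷ v))

ins-∷ʳ : ∀ a w x F → ins a (w ∷ʳ x) F ≡ ins a w (λ v → F (v ∷ʳ x)) + F (w ∷ʳ x ∷ʳ a)
ins-∷ʳ a []      x F = refl
ins-∷ʳ a (y ∷ w) x F = trans (cong (F (a ∷ y ∷ w ∷ʳ x) +_) (ins-∷ʳ a w x _))
  (sym (ℕP.+-assoc (F (a ∷ y ∷ w ∷ʳ x)) _ _))

ins-reverse : ∀ a w F → ins a w (λ v → F (reverse v)) ≡ ins a (reverse w) F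
ins-reverse a []      F = refl
ins-reverse a (x ∷ w) F = begin
  F (reverse (a ∷ x ∷ w)) + ins a w (λ v → F (reverse (x ∷ v)))
    ≡⟨ cong₂ _+_ (cong F (trans (unfold-reverse a (x ∷ w)) (cong (_∷ʳ a) (unfold-reverse x w))))
         (trans (ins-ext a w λ v → cong F (unfold-reverse x v)) (ins-reverse a w (λ v → F (v ∷ʳ x)))) ⟩
  F (reverse w ∷ʳ x ∷ʳ a) + ins a (reverse w) (λ v → F (v ∷ʳ x))
    ≡⟨ ℕP.+-comm (F (reverse w ∷ʳ x ∷ʳ a)) _ ⟩
  ins a (reverse w) (λ v → F (v ∷ʳ x)) + F (reverse w ∷ʳ x ∷ʳ a)
    ≡⟨ ins-∷ʳ a (reverse w) x F ⟨
  ins a (reverse w ∷ʳ x) F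
    ≡⟨ cong (λ u → ins a u F) (unfold-reverse x w) ⟨
  ins a (reverse (x ∷ w)) F ∎

-- Peeling off a first letter does not fit reversal, but inserting `a` at all places is symmetric
-- under it (`ins-reverse`), so the induction goes over inserted letters.
arr-reverse : ∀ k A F → length A ≡ k → arr k A (λ w → F (reverse w)) ≡ arr k A F
arr-reverse zero    []      F l = refl
arr-reverse (suc k) (a ∷ A) F l = begin
  arr (suc k) (a ∷ A) (λ w → F (reverse w))        ≡⟨ arr-ins k a A _ l' ⟩
  arr k A (λ w → ins a w (λ v → F (reverse v)))    ≡⟨ arr-ext k A (λ w → ins-reverse a w F) ⟩
  arr k A (λ w → ins a (reverse w) F)              ≡⟨ arr-reverse k A (λ w → ins a w F) l' ⟩
  arr k A (λ w → ins a w F)                        ≡⟨ arr-ins k a A F l' ⟨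
  arr (suc k) (a ∷ A) F ∎
  where l' = ℕP.suc-injective l

-- Denert's statistic as a sum over cyclic intervals

-- A numerical indicator, so that case distinctions become polynomial identities. The condition x ≤
-- j appears as `lt x (suc j)`.
lt : ℕ → ℕ → ℕ
lt _       zero    = 0
lt zero    (suc _) = 1
lt (suc a) (suc b) = lt a b

lt-yes : ∀ {a b} → a < b → lt a b ≡ 1
lt-yes {zero}  (s≤s p) = refl
lt-yes {suc a} (s≤s p) = lt-yes p

lt-no : ∀ {a b} → b ≤ a → lt a b ≡ 0
lt-no {a}     {zero}  p       = refl
lt-no {suc a} {suc b} (s≤s p) = lt-no p

lt-dec : ∀ a b → lt a b + lt b (suc a) ≡ 1
lt-dec zero    zero    = refl
lt-dec zero    (suc b) = cong suc (lt-no {b} z≤n)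
lt-dec (suc a) zero    = refl
lt-dec (suc a) (suc b) = lt-dec a b

eqn : ℕ → ℕ → ℕ
eqn zero    zero    = 1
eqn zero    (suc _) = 0
eqn (suc _) zero    = 0
eqn (suc a) (suc b) = eqn a b

lt-sucʳ : ∀ y j → lt y (suc j) ≡ lt y j + eqn y j
lt-sucʳ zero    zero    = refl
lt-sucʳ zero    (suc j) = refl
lt-sucʳ (suc y) zero    = refl
lt-sucʳ (suc y) (suc j) = lt-sucʳ y j

lt-sucˡ : ∀ y j → lt j y ≡ lt (suc j) y + eqn y (suc j)
lt-sucˡ zero    j       = refl
lt-sucˡ (suc y) zero    = lem y
  where
  lem : ∀ y → 1 ≡ lt 0 y + eqn y 0
  lem zero    = refl
  lem (suc y) = refl
lt-sucˡ (suc y) (suc j) = lt-sucˡ y j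

eqn-subst : ∀ y j (f : ℕ → ℕ) → eqn y j * f y ≡ eqn y j * f j
eqn-subst zero    zero    f = refl
eqn-subst zero    (suc j) f = refl
eqn-subst (suc y) zero    f = refl
eqn-subst (suc y) (suc j) f = eqn-subst y j (λ k → f (suc k))

eqn-no : ∀ {y j} → y < j → eqn y j ≡ 0
eqn-no {zero}  (s≤s p) = refl
eqn-no {suc y} (s≤s p) = eqn-no p

down : ℕ → List ℕ
down zero    = []
down (suc n) = suc n ∷ down n

length-down : ∀ n → length (down n) ≡ n
length-down zero    = refl
length-down (suc n) = cong suc (length-down n)

∑-down : ∀ {n j} → n ≤ j → ∑ (λ y → lt y (suc j)) (down n) ≡ n
∑-down {zero}  p = refl
∑-down {suc n} p = cong₂ _+_ (lt-yes (s≤s p)) (∑-down (ℕP.<⇒≤ p))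

∑-down′ : ∀ {n j} → j ≤ n → ∑ (λ y → lt y (suc j)) (down n) ≡ j
∑-down′ {n} j≤n with ℕP.m≤n⇒m<n∨m≡n j≤n
... | inj₂ refl = ∑-down {n} ℕP.≤-refl
∑-down′ {suc n} _ | inj₁ (s≤s p) = cong₂ _+_ (lt-no p) (∑-down′ p)

∑-*ˡ : ∀ {A : Set} c (f : A → ℕ) xs → ∑ (λ x → c * f x) xs ≡ c * ∑ f xs
∑-*ˡ c f []       = sym (ℕP.*-zeroʳ c)
∑-*ˡ c f (x ∷ xs) = trans (cong (c * f x +_) (∑-*ˡ c f xs)) (sym (ℕP.*-distribˡ-+ c (f x) _))

∑-one : ∀ (f : ℕ → ℕ) xs → (∀ y → f y ≡ 1) → ∑ f xs ≡ length xs
∑-one f []       eq = refl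
∑-one f (x ∷ xs) eq = cong₂ _+_ (eq x) (∑-one f xs eq)

-- Words are read backwards here: the head of x ∷ xs is the letter at position 1 + length xs.
excW nexcW : (ℕ → ℕ) → List ℕ → ℕ
excW f []       = 0
excW f (x ∷ xs) = lt (suc (length xs)) x * f x + excW f xs
nexcW f []       = 0
nexcW f (x ∷ xs) = lt x (suc (suc (length xs))) * f x + nexcW f xs

-- The last letter forms inversions only with earlier letters of its own class, and adds its
-- position if it is an excedance.
rden : List ℕ → ℕ
rden []       = 0
rden (x ∷ xs) = rden xs + (lt j x * (j + excW (lt x) xs) + lt x (suc j) * nexcW (lt x) xs)
  where j = suc (length xs)

-- The number of letters of xs in the cyclic interval ]x, j].
cyc : ℕ → ℕ → List ℕ → ℕ
cyc x j xs = lt j x * (∑ (lt x) xs + ∑ (λ y → lt y (suc j)) xs)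
           + lt x (suc j) * ∑ (λ y → lt x y * lt y (suc j)) xs

code : List ℕ → ℕ
code []       = 0
code (x ∷ xs) = cyc x (suc (length xs)) xs + code xs

tri : ℕ → ℕ
tri zero    = 0
tri (suc n) = suc n + tri n

exc+nexc : ∀ f xs → excW f xs + nexcW f xs ≡ ∑ f xs
exc+nexc f []       = refl
exc+nexc f (x ∷ xs) = begin
  (a * f x + excW f xs) + (b * f x + nexcW f xs) ≡⟨ lem a (f x) (excW f xs) b (nexcW f xs) ⟩
  (a + b) * f x + (excW f xs + nexcW f xs)
    ≡⟨ cong₂ (λ u v → u * f x + v) (lt-dec (suc (length xs)) x) (exc+nexc f xs) ⟩
  1 * f x + ∑ f xs ≡⟨ cong (_+ ∑ f xs) (ℕP.*-identityˡ (f x)) ⟩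
  f x + ∑ f xs ∎
  where
  a = lt (suc (length xs)) x
  b = lt x (suc (suc (length xs)))
  lem : ∀ a f e b n → (a * f + e) + (b * f + n) ≡ (a + b) * f + (e + n)
  lem = solve-∀

nexcW-cong : ∀ {f g} xs → (∀ y → y ≤ length xs → f y ≡ g y) → nexcW f xs ≡ nexcW g xs
nexcW-cong []       eq = refl
nexcW-cong {f} {g} (x ∷ xs) eq = cong₂ _+_ head (nexcW-cong xs λ y p → eq y (ℕP.m≤n⇒m≤1+n p))
  where
  head : lt x (suc (suc (length xs))) * f x ≡ lt x (suc (suc (length xs))) * g x
  head with ℕP.≤-<-connex x (suc (length xs))
  ... | inj₁ p = cong (lt x (suc (suc (length xs))) *_) (eq x p)
  ... | inj₂ p rewrite lt-no p = refl

nexcW-0 : ∀ xs → nexcW (λ _ → 0) xs ≡ 0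
nexcW-0 []       = refl
nexcW-0 (x ∷ xs) = cong₂ _+_ (ℕP.*-zeroʳ (lt x (suc (suc (length xs))))) (nexcW-0 xs)

-- A non-excedance letter is at most its position, hence at most `length xs`, where f vanishes.
excW-all : ∀ f xs → (∀ y → y ≤ length xs → f y ≡ 0) → excW f xs ≡ ∑ f xs
excW-all f xs eq = trans (sym (ℕP.+-identityʳ _))
  (trans (cong (excW f xs +_) (sym (trans (nexcW-cong xs eq) (nexcW-0 xs)))) (exc+nexc f xs))

excW-cong : ∀ {f g} xs → (∀ y → f y ≡ g y) → excW f xs ≡ excW g xs
excW-cong []       eq = refl
excW-cong (x ∷ xs) eq = cong₂ (λ u v → lt (suc (length xs)) x * u + v) (eq x) (excW-cong xs eq)

excW-+ : ∀ f g xs → excW (λ y → f y + g y) xs ≡ excW f xs + excW g xs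
excW-+ f g []       = refl
excW-+ f g (x ∷ xs) = trans (cong (lt (suc (length xs)) x * (f x + g x) +_) (excW-+ f g xs))
  (lem (lt (suc (length xs)) x) (f x) (g x) (excW f xs) (excW g xs))
  where
  lem : ∀ a f g e e' → a * (f + g) + (e + e') ≡ (a * f + e) + (a * g + e')
  lem = solve-∀

excW-eqn : ∀ f xs j → length xs < j → excW (λ y → eqn y j * f y) xs ≡ ∑ (λ y → eqn y j) xs * f j
excW-eqn f xs j l = begin
  excW (λ y → eqn y j * f y) xs
    ≡⟨ excW-all _ xs (λ y p → cong (_* f y) (eqn-no (ℕP.≤-<-trans p l))) ⟩
  ∑ (λ y → eqn y j * f y) xs
    ≡⟨ ∑-cong xs (λ y → trans (eqn-subst y j f) (ℕP.*-comm (eqn y j) (f j))) ⟩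
  ∑ (λ y → f j * eqn y j) xs ≡⟨ ∑-*ˡ (f j) _ xs ⟩
  f j * ∑ (λ y → eqn y j) xs ≡⟨ ℕP.*-comm (f j) _ ⟩
  ∑ (λ y → eqn y j) xs * f j ∎

below : List ℕ → ℕ → ℕ
below ρ y = ∑ (λ z → lt z y) ρ

module _ {n x} (xs ρ : List ℕ) (perm : xs ++ x ∷ ρ ↭ down n) where

  private
    j g e : ℕ
    j = suc (length xs)
    g = ∑ (lt j) xs
    e = ∑ (λ y → eqn y j) xs

    j≤n : j ≤ n
    j≤n = subst (j ≤_) (trans (trans (sym (ℕP.+-suc (length xs) (length ρ))) (sym (length-++ xs)))
      (trans (↭-length perm) (length-down n))) (s≤s (ℕP.m≤m+n (length xs) (length ρ)))

    total : ∀ f → ∑ f xs + ∑ f (x ∷ ρ) ≡ ∑ f (down n)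
    total f = trans (sym (∑-++ f xs (x ∷ ρ))) (∑-↭ f perm)

  -- Exactly `length xs` letters lie below j, and `xs` has `length xs` letters, each below, equal to
  -- or above j. So `xs` lacks as many small letters as it has letters that are at least j.
  missing : below (x ∷ ρ) j ≡ e + g
  missing = ℕP.+-cancelˡ-≡ (∑ (λ y → lt y j) xs) _ _ (begin
    ∑ (λ y → lt y j) xs + below (x ∷ ρ) j ≡⟨ total _ ⟩
    ∑ (λ y → lt y j) (down n) ≡⟨ ∑-down′ (ℕP.<⇒≤ j≤n) ⟩
    length xs ≡⟨ ∑-one _ xs (λ y → trans (sym (ℕP.+-assoc (lt y j) _ _))
        (trans (cong (_+ lt j y) (sym (lt-sucʳ y j))) (trans (ℕP.+-comm (lt y (suc j)) _) (lt-dec j y)))) ⟨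
    ∑ (λ y → lt y j + (eqn y j + lt j y)) xs
      ≡⟨ trans (∑-+ _ _ xs) (cong (∑ (λ y → lt y j) xs +_) (∑-+ _ _ xs)) ⟩
    ∑ (λ y → lt y j) xs + (e + g) ∎)

  e≤1 : e ≤ 1
  e≤1 = subst (e ≤_) (ℕP.+-cancelˡ-≡ (length xs) _ _ (begin
    length xs + ∑ (λ y → eqn y j) (down n)
      ≡⟨ cong (_+ ∑ (λ y → eqn y j) (down n)) (∑-down′ (ℕP.<⇒≤ j≤n)) ⟨
    ∑ (λ y → lt y j) (down n) + ∑ (λ y → eqn y j) (down n) ≡⟨ ∑-+ _ _ (down n) ⟨
    ∑ (λ y → lt y j + eqn y j) (down n) ≡⟨ ∑-cong (down n) (λ y → sym (lt-sucʳ y j)) ⟩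
    ∑ (λ y → lt y (suc j)) (down n) ≡⟨ ∑-down′ j≤n ⟩
    j ≡⟨ ℕP.+-comm 1 (length xs) ⟩
    length xs + 1 ∎))
    (subst (e ≤_) (total _) (ℕP.m≤m+n e _))

  -- When the threshold moves from `length xs` to j, the letter j, if in `xs`, stops counting as
  -- beyond the prefix. `tri` then drops by g + 1, which by `missing` is the number of smaller
  -- letters still to come.
  tri-step : tri (∑ (lt (length xs)) xs) ≡ tri g + e * below (x ∷ ρ) j
  tri-step = trans (cong tri (trans (∑-cong xs (λ y → lt-sucˡ y (length xs))) (∑-+ _ _ xs)))
    (trans (lem e e≤1) (cong (λ t → tri g + e * t) (sym missing)))
    where
    lem : ∀ e → e ≤ 1 → tri (g + e) ≡ tri g + e * (e + g)
    lem zero          _ = trans (cong tri (ℕP.+-identityʳ g)) (sym (ℕP.+-identityʳ (tri g)))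
    lem (suc zero)    _ = trans (cong tri (ℕP.+-comm g 1))
      (trans (ℕP.+-comm (suc g) (tri g)) (cong (tri g +_) (sym (ℕP.*-identityˡ (suc g)))))
    lem (suc (suc _)) (s≤s ())

  -- If j occurs in `xs`, it stands before position j and is an excedance letter, so it enters the
  -- sum with `f j`. For `f = below (x ∷ ρ)` this makes up for the loss in `tri-step`.
  weight-step : ∀ f → excW (λ y → lt y (suc j) * f y) xs ≡ excW (λ y → lt y j * f y) xs + e * f j
  weight-step f = trans
    (excW-cong xs λ y → trans (cong (_* f y) (lt-sucʳ y j)) (ℕP.*-distribʳ-+ (f y) (lt y j) (eqn y j)))
    (trans (excW-+ _ _ xs) (cong (excW (λ y → lt y j * f y) xs +_) (excW-eqn f xs j ℕP.≤-refl)))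

  private
    A A' B C D X : ℕ
    A = excW (lt x) xs
    A' = ∑ (lt x) xs
    B = nexcW (lt x) xs
    C = ∑ (λ y → lt y (suc j)) xs
    D = ∑ (λ y → lt x y * lt y (suc j)) xs
    X = excW (λ y → lt y (suc j) * below ρ y) xs

    j≡ : j ≡ suc (C + g)
    j≡ = cong suc (sym (trans (sym (∑-+ _ _ xs)) (∑-one _ xs λ y → trans (ℕP.+-comm (lt y (suc j)) _) (lt-dec j y))))

    E-exc : j < x → excW (λ y → lt y (suc j) * below (x ∷ ρ) y) xs ≡ X
    E-exc j<x = excW-cong xs λ y → lem y (ℕP.<-≤-connex j y)
      where
      lem : ∀ y → j < y ⊎ y ≤ j → lt y (suc j) * (lt x y + below ρ y) ≡ lt y (suc j) * below ρ y
      lem y (inj₁ p) rewrite lt-no p = refl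
      lem y (inj₂ p) rewrite lt-no (ℕP.≤-trans p (ℕP.<⇒≤ j<x)) = refl

    E-nexc : excW (λ y → lt y (suc j) * below (x ∷ ρ) y) xs ≡ excW (λ y → lt x y * lt y (suc j)) xs + X
    E-nexc = trans (excW-cong xs λ y → trans (ℕP.*-distribˡ-+ (lt y (suc j)) (lt x y) (below ρ y))
        (cong (_+ lt y (suc j) * below ρ y) (ℕP.*-comm (lt y (suc j)) (lt x y))))
      (excW-+ _ _ xs)

    D≡ : excW (λ y → lt x y * lt y (suc j)) xs + B ≡ D
    D≡ = trans (cong (excW (λ y → lt x y * lt y (suc j)) xs +_)
        (nexcW-cong xs λ y p → sym (trans (cong (lt x y *_) (lt-yes (s≤s (ℕP.m≤n⇒m≤1+n p)))) (ℕP.*-identityʳ (lt x y)))))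
      (exc+nexc _ xs)

    lem : ∀ c t X C g A B b D → c + t + X + (1 * (suc (C + g) + A) + 0 * B)
      ≡ ((1 * (A + C) + 0 * D) + c) + (suc g + t) + (1 * (0 * b) + X)
    lem = solve-∀
    lem₂ : ∀ c t E X J B S b → c + t + (E + X) + (0 * J + 1 * B)
      ≡ ((0 * S + 1 * (E + B)) + c) + (0 + t) + (0 * b + X)
    lem₂ = solve-∀

  private
    next : rden xs ≡ code xs + tri (∑ (lt (length xs)) xs)
             + excW (λ y → lt y (suc (length xs)) * below (x ∷ ρ) y) xs →
      rden xs ≡ code xs + tri g + excW (λ y → lt y (suc j) * below (x ∷ ρ) y) xs
    next ih = trans ih (trans (cong (λ t → code xs + t + excW (λ y → lt y j * below (x ∷ ρ) y) xs) tri-step)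
      (trans (lem₃ (code xs) (tri g) (e * below (x ∷ ρ) j) (excW (λ y → lt y j * below (x ∷ ρ) y) xs))
        (cong (code xs + tri g +_) (sym (weight-step (below (x ∷ ρ)))))))
      where
      lem₃ : ∀ c t b E → c + (t + b) + E ≡ c + t + (E + b)
      lem₃ = solve-∀

  -- The change of threshold cancels by `next`, which leaves the effect of x. If j < x, then apart
  -- from the letters above x, `rden` gains j and the code only the letters of `xs` up to j; the
  -- difference g + 1 is the growth of `tri`. If x ≤ j, the code also counts the excedance letters
  -- in ]x, j], and these are the pairs that leave the potential once x is no longer to come.
  code-step : rden xs ≡ code xs + tri (∑ (lt (length xs)) xs)
                + excW (λ y → lt y (suc (length xs)) * below (x ∷ ρ) y) xs →
    rden (x ∷ xs) ≡ code (x ∷ xs) + tri (∑ (lt j) (x ∷ xs))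
                + excW (λ y → lt y (suc j) * below ρ y) (x ∷ xs)
  code-step ih with ℕP.<-≤-connex j x
  ... | inj₁ j<x = begin
    rden xs + (lt j x * (j + A) + lt x (suc j) * B)
      ≡⟨ cong₂ (λ u v → rden xs + (u * (j + A) + v * B)) (lt-yes j<x) (lt-no j<x) ⟩
    rden xs + (1 * (j + A) + 0 * B)
      -- The letters of `xs` above x exceed j and so their own positions: all of them are
      -- excedances.
      ≡⟨ cong₂ (λ u v → rden xs + (1 * (u + v) + 0 * B)) j≡ (excW-all _ xs λ y p → lt-no (ℕP.≤-trans p (ℕP.<⇒≤ (ℕP.<-trans ℕP.≤-refl j<x)))) ⟩
    rden xs + (1 * (suc (C + g) + A') + 0 * B)
      ≡⟨ cong (_+ (1 * (suc (C + g) + A') + 0 * B)) (trans (next ih) (cong (code xs + tri g +_) (E-exc j<x))) ⟩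
    code xs + tri g + X + (1 * (suc (C + g) + A') + 0 * B)
      ≡⟨ lem (code xs) (tri g) X C g A' B (below ρ x) D ⟩
    ((1 * (A' + C) + 0 * D) + code xs) + (suc g + tri g) + (1 * (0 * below ρ x) + X)
      ≡⟨ cong₂ (λ u v → ((u * (A' + C) + v * D) + code xs) + tri (u + g) + (u * (v * below ρ x) + X))
          (lt-yes j<x) (lt-no j<x) ⟨
    ((lt j x * (A' + C) + lt x (suc j) * D) + code xs) + tri (lt j x + g) + (lt j x * (lt x (suc j) * below ρ x) + X) ∎
  ... | inj₂ x≤j = begin
    rden xs + (lt j x * (j + A) + lt x (suc j) * B)
      ≡⟨ cong₂ (λ u v → rden xs + (u * (j + A) + v * B)) (lt-no x≤j) (lt-yes (s≤s x≤j)) ⟩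
    rden xs + (0 * (j + A) + 1 * B)
      ≡⟨ cong (_+ (0 * (j + A) + 1 * B)) (trans (next ih) (cong (code xs + tri g +_) E-nexc)) ⟩
    code xs + tri g + (excW (λ y → lt x y * lt y (suc j)) xs + X) + (0 * (j + A) + 1 * B)
      ≡⟨ lem₂ (code xs) (tri g) (excW (λ y → lt x y * lt y (suc j)) xs) X (j + A) B (A' + C) (lt x (suc j) * below ρ x) ⟩
    ((0 * (A' + C) + 1 * (excW (λ y → lt x y * lt y (suc j)) xs + B)) + code xs) + (0 + tri g) + (0 * (lt x (suc j) * below ρ x) + X)
      ≡⟨ cong (λ t → ((0 * (A' + C) + 1 * t) + code xs) + (0 + tri g) + (0 * (lt x (suc j) * below ρ x) + X)) D≡ ⟩
    ((0 * (A' + C) + 1 * D) + code xs) + (0 + tri g) + (0 * (lt x (suc j) * below ρ x) + X)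
      ≡⟨ cong₂ (λ u v → ((u * (A' + C) + v * D) + code xs) + tri (u + g) + (u * (lt x (suc j) * below ρ x) + X))
          (lt-no x≤j) (lt-yes (s≤s x≤j)) ⟨
    ((lt j x * (A' + C) + lt x (suc j) * D) + code xs) + tri (lt j x + g) + (lt j x * (lt x (suc j) * below ρ x) + X) ∎

-- The difference between the prefix contributions to den and the code is a potential:
-- tri of the number of letters beyond the prefix, plus the pairs of an excedance letter
-- y ≤ length xs and a smaller letter that occurs after the prefix.
rden-potential : ∀ {n} xs ρ → xs ++ ρ ↭ down n → rden xs ≡ code xs + tri (∑ (lt (length xs)) xs)
  + excW (λ y → lt y (suc (length xs)) * below ρ y) xs
rden-potential []       ρ p = refl
rden-potential (x ∷ xs) ρ p = code-step xs ρ p' (rden-potential xs (x ∷ ρ) p')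
  where p' = ↭-trans (shift x xs ρ) p

-- For the whole word no letter exceeds the length and none is still to come, so both terms of the
-- potential vanish.
rden≡code : ∀ n xs → xs ↭ down n → rden xs ≡ code xs
rden≡code n xs p = begin
  rden xs ≡⟨ rden-potential xs [] (subst (_↭ down n) (sym (++-identityʳ xs)) p) ⟩
  code xs + tri (∑ (lt (length xs)) xs) + excW (λ y → lt y (suc (length xs)) * 0) xs
    ≡⟨ cong₂ (λ u v → code xs + tri u + v) large
         (trans (excW-cong xs λ y → ℕP.*-zeroʳ (lt y (suc (length xs))))
           (trans (excW-all _ xs λ _ _ → refl) (trans (∑-*ˡ 0 (λ _ → 0) xs) refl))) ⟩
  code xs + 0 + 0 ≡⟨ trans (ℕP.+-identityʳ _) (ℕP.+-identityʳ _) ⟩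
  code xs ∎
  where
  lem : ∀ k n → n ≤ k → ∑ (lt k) (down n) ≡ 0
  lem k zero    _ = refl
  lem k (suc n) l = cong₂ _+_ (lt-no l) (lem k n (ℕP.<⇒≤ l))
  large : ∑ (lt (length xs)) xs ≡ 0
  large = trans (∑-↭ _ p) (lem _ n (ℕP.≤-reflexive (sym (trans (↭-length p) (length-down n)))))

-- The statistics `den` and `exc` of a reversed word

∑-filter : ∀ {A : Set} {P : A → Set} (P? : Decidable P) (ind f : A → ℕ) xs →
  (∀ x → P x → ind x ≡ 1) → (∀ x → ¬ P x → ind x ≡ 0) →
  ∑ f (filter P? xs) ≡ ∑ (λ x → ind x * f x) xs
∑-filter P? ind f []       y n = refl
∑-filter P? ind f (x ∷ xs) y n with P? x
... | yes p rewrite y x p = cong₂ _+_ (sym (ℕP.+-identityʳ (f x))) (∑-filter P? ind f xs y n)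
... | no ¬p rewrite n x ¬p = ∑-filter P? ind f xs y n

length-filter-∑ : ∀ {A : Set} {P : A → Set} (P? : Decidable P) (ind : A → ℕ) xs →
  (∀ x → P x → ind x ≡ 1) → (∀ x → ¬ P x → ind x ≡ 0) →
  length (filter P? xs) ≡ ∑ ind xs
length-filter-∑ P? ind []       y n = refl
length-filter-∑ P? ind (x ∷ xs) y n with P? x
... | yes p rewrite y x p = cong suc (length-filter-∑ P? ind xs y n)
... | no ¬p rewrite n x ¬p = length-filter-∑ P? ind xs y n

inv-∷ʳ : ∀ w x → inv (w ∷ʳ x) ≡ inv w + ∑ (lt x) w
inv-∷ʳ []      x = refl
inv-∷ʳ (y ∷ w) x = begin
  length (filter (_<? y) (w ∷ʳ x)) + inv (w ∷ʳ x)
    ≡⟨ cong₂ _+_ (trans (smaller (w ∷ʳ x)) (∑-++ (λ z → lt z y) w [ x ])) (inv-∷ʳ w x) ⟩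
  (∑ (λ z → lt z y) w + (lt x y + 0)) + (inv w + ∑ (lt x) w)
    ≡⟨ lem (∑ (λ z → lt z y) w) (lt x y) (inv w) (∑ (lt x) w) ⟩
  (∑ (λ z → lt z y) w + inv w) + (lt x y + ∑ (lt x) w)
    ≡⟨ cong (λ t → (t + inv w) + (lt x y + ∑ (lt x) w)) (smaller w) ⟨
  (length (filter (_<? y) w) + inv w) + (lt x y + ∑ (lt x) w) ∎
  where
  smaller : ∀ u → length (filter (_<? y) u) ≡ ∑ (λ z → lt z y) u
  smaller u = length-filter-∑ (_<? y) _ u (λ _ → lt-yes) (λ _ p → lt-no (ℕP.≮⇒≥ p))
  lem : ∀ a b c d → (a + (b + 0)) + (c + d) ≡ (a + c) + (b + d)
  lem = solve-∀

zip-∷ʳ : ∀ {A B : Set} (xs : List A) (ys : List B) x y → length xs ≡ length ys →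
  zip (xs ∷ʳ x) (ys ∷ʳ y) ≡ zip xs ys ∷ʳ (x , y)
zip-∷ʳ []       []       x y l = refl
zip-∷ʳ (u ∷ xs) (v ∷ ys) x y l = cong ((u , v) ∷_) (zip-∷ʳ xs ys x y (ℕP.suc-injective l))

length-range : ∀ n → length (range n) ≡ n
length-range n = trans (length-map suc (upTo n)) (length-upTo n)

range-∷ʳ : ∀ n → range (suc n) ≡ range n ∷ʳ suc n
range-∷ʳ n = trans (cong (map suc) (sym (upTo-∷ʳ n))) (map-++ suc (upTo n) [ n ])

pos-∷ʳ : ∀ σ x → pos (σ ∷ʳ x) ≡ pos σ ∷ʳ (suc (length σ) , x)
pos-∷ʳ σ x = trans (cong (λ k → zip k (σ ∷ʳ x))
    (trans (cong range (trans (length-++ σ) (ℕP.+-comm (length σ) 1))) (range-∷ʳ (length σ))))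
  (zip-∷ʳ (range (length σ)) σ _ x (length-range (length σ)))

pos-reverse-∷ : ∀ x xs → pos (reverse (x ∷ xs)) ≡ pos (reverse xs) ∷ʳ (suc (length xs) , x)
pos-reverse-∷ x xs = trans (cong pos (unfold-reverse x xs))
  (trans (pos-∷ʳ (reverse xs) x) (cong (λ k → pos (reverse xs) ∷ʳ (suc k , x)) (length-reverse xs)))

exc? : (p : ℕ × ℕ) → Dec (isExc p)
exc? p = proj₁ p <? proj₂ p

excP nexcP : List ℕ → List (ℕ × ℕ)
excP σ  = filter exc? (pos σ)
nexcP σ = filter (λ p → ¬? (exc? p)) (pos σ)

module _ (x : ℕ) (xs : List ℕ) where
  private
    j : ℕ
    j = suc (length xs)

  excP-yes : j < x → excP (reverse (x ∷ xs)) ≡ excP (reverse xs) ∷ʳ (j , x)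
  excP-yes p = trans (cong (filter _) (pos-reverse-∷ x xs))
    (trans (filter-++ _ (pos (reverse xs)) _) (cong (excP (reverse xs) ++_) (filter-accept exc? {j , x} p)))

  excP-no : x ≤ j → excP (reverse (x ∷ xs)) ≡ excP (reverse xs)
  excP-no p = trans (cong (filter _) (pos-reverse-∷ x xs))
    (trans (filter-++ _ (pos (reverse xs)) _)
      (trans (cong (excP (reverse xs) ++_) (filter-reject exc? {j , x} (ℕP.≤⇒≯ p))) (++-identityʳ _)))

  nexcP-yes : x ≤ j → nexcP (reverse (x ∷ xs)) ≡ nexcP (reverse xs) ∷ʳ (j , x)
  nexcP-yes p = trans (cong (filter _) (pos-reverse-∷ x xs))
    (trans (filter-++ _ (pos (reverse xs)) _) (cong (nexcP (reverse xs) ++_) (filter-accept (λ p → ¬? (exc? p)) {j , x} (ℕP.≤⇒≯ p))))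

  nexcP-no : j < x → nexcP (reverse (x ∷ xs)) ≡ nexcP (reverse xs)
  nexcP-no p = trans (cong (filter _) (pos-reverse-∷ x xs))
    (trans (filter-++ _ (pos (reverse xs)) _)
      (trans (cong (nexcP (reverse xs) ++_) (filter-reject (λ p → ¬? (exc? p)) {j , x} (λ np → np p))) (++-identityʳ _)))

∑-snoc : ∀ f (L : List (ℕ × ℕ)) j x → ∑ f (map proj₂ (L ∷ʳ (j , x))) ≡ 1 * f x + ∑ f (map proj₂ L)
∑-snoc f L j x = trans (cong (∑ f) (map-++ proj₂ L _)) (trans (∑-++ f (map proj₂ L) _) (ℕP.+-comm _ (f x + 0)))

∑-excP : ∀ f xs → ∑ f (map proj₂ (excP (reverse xs))) ≡ excW f xs
∑-excP f []       = refl
∑-excP f (x ∷ xs) with ℕP.<-≤-connex (suc (length xs)) x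
... | inj₁ p = trans (cong (λ L → ∑ f (map proj₂ L)) (excP-yes x xs p))
  (trans (∑-snoc f (excP (reverse xs)) _ x) (cong₂ (λ u v → u * f x + v) (sym (lt-yes p)) (∑-excP f xs)))
... | inj₂ p = trans (cong (λ L → ∑ f (map proj₂ L)) (excP-no x xs p))
  (trans (∑-excP f xs) (cong (λ u → u * f x + excW f xs) (sym (lt-no p))))

∑-nexcP : ∀ f xs → ∑ f (map proj₂ (nexcP (reverse xs))) ≡ nexcW f xs
∑-nexcP f []       = refl
∑-nexcP f (x ∷ xs) with ℕP.<-≤-connex (suc (length xs)) x
... | inj₂ p = trans (cong (λ L → ∑ f (map proj₂ L)) (nexcP-yes x xs p))
  (trans (∑-snoc f (nexcP (reverse xs)) _ x) (cong₂ (λ u v → u * f x + v) (sym (lt-yes (s≤s p))) (∑-nexcP f xs)))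
... | inj₁ p = trans (cong (λ L → ∑ f (map proj₂ L)) (nexcP-no x xs p))
  (trans (∑-nexcP f xs) (cong (λ u → u * f x + nexcW f xs) (sym (lt-no p))))

denFrom : List (ℕ × ℕ) → List (ℕ × ℕ) → ℕ
denFrom E N = sum (map proj₁ E) + inv (map proj₂ E) + inv (map proj₂ N)

inv-snoc : ∀ (L : List (ℕ × ℕ)) j x → inv (map proj₂ (L ∷ʳ (j , x))) ≡ inv (map proj₂ L) + ∑ (lt x) (map proj₂ L)
inv-snoc L j x = trans (cong inv (map-++ proj₂ L [ j , x ])) (inv-∷ʳ (map proj₂ L) x)

den-reverse : ∀ xs → den (reverse xs) ≡ rden xs
den-reverse []       = refl
den-reverse (x ∷ xs) = trans (step (ℕP.<-≤-connex j x)) (cong (_+ δ) (den-reverse xs))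
  where
  j = suc (length xs)
  E = excP (reverse xs)
  N = nexcP (reverse xs)
  δ = lt j x * (j + excW (lt x) xs) + lt x (suc j) * nexcW (lt x) xs
  lem₁ : ∀ a b c j e f → (a + (j + 0)) + (b + e) + c ≡ (a + b + c) + (1 * (j + e) + 0 * f)
  lem₁ = solve-∀
  lem₂ : ∀ a b c e f → a + b + (c + f) ≡ (a + b + c) + (0 * e + 1 * f)
  lem₂ = solve-∀
  step : j < x ⊎ x ≤ j → denFrom (excP (reverse (x ∷ xs))) (nexcP (reverse (x ∷ xs))) ≡ denFrom E N + δ
  step (inj₁ p) = begin
    denFrom (excP (reverse (x ∷ xs))) (nexcP (reverse (x ∷ xs)))
      ≡⟨ cong₂ denFrom (excP-yes x xs p) (nexcP-no x xs p) ⟩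
    ∑ proj₁ (E ∷ʳ (j , x)) + inv (map proj₂ (E ∷ʳ (j , x))) + inv (map proj₂ N)
      ≡⟨ cong₂ (λ u v → u + v + inv (map proj₂ N)) (∑-++ proj₁ E [ j , x ])
          (trans (inv-snoc E j x) (cong (inv (map proj₂ E) +_) (∑-excP (lt x) xs))) ⟩
    (∑ proj₁ E + (j + 0)) + (inv (map proj₂ E) + excW (lt x) xs) + inv (map proj₂ N)
      ≡⟨ lem₁ (∑ proj₁ E) (inv (map proj₂ E)) (inv (map proj₂ N)) j (excW (lt x) xs) (nexcW (lt x) xs) ⟩
    denFrom E N + (1 * (j + excW (lt x) xs) + 0 * nexcW (lt x) xs)
      ≡⟨ cong₂ (λ u v → denFrom E N + (u * (j + excW (lt x) xs) + v * nexcW (lt x) xs)) (lt-yes p) (lt-no p) ⟨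
    denFrom E N + δ ∎
  step (inj₂ p) = begin
    denFrom (excP (reverse (x ∷ xs))) (nexcP (reverse (x ∷ xs)))
      ≡⟨ cong₂ denFrom (excP-no x xs p) (nexcP-yes x xs p) ⟩
    denFrom E (N ∷ʳ (j , x))
      ≡⟨ cong (sum (map proj₁ E) + inv (map proj₂ E) +_)
          (trans (inv-snoc N j x) (cong (inv (map proj₂ N) +_) (∑-nexcP (lt x) xs))) ⟩
    sum (map proj₁ E) + inv (map proj₂ E) + (inv (map proj₂ N) + nexcW (lt x) xs)
      ≡⟨ lem₂ (∑ proj₁ E) (inv (map proj₂ E)) (inv (map proj₂ N)) (j + excW (lt x) xs) (nexcW (lt x) xs) ⟩
    denFrom E N + (0 * (j + excW (lt x) xs) + 1 * nexcW (lt x) xs)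
      ≡⟨ cong₂ (λ u v → denFrom E N + (u * (j + excW (lt x) xs) + v * nexcW (lt x) xs)) (lt-no p) (lt-yes (s≤s p)) ⟨
    denFrom E N + δ ∎

rexc : ℕ → List ℕ → ℕ
rexc s []       = 0
rexc s (x ∷ xs) = lt (suc (length xs)) x * lt s (suc (length xs)) + rexc s xs

exc-reverse : ∀ s xs → exc (suc s) (reverse xs) ≡ rexc s xs
exc-reverse s xs = trans (length-filter-∑ _ ind (pos (reverse xs))
    (λ { (i , v) (p , q) → cong₂ _*_ (lt-yes p) (lt-yes q) }) out) (go xs)
  where
  ind : ℕ × ℕ → ℕ
  ind (i , v) = lt i v * lt s i
  out : ∀ p → ¬ (proj₁ p < proj₂ p × suc s ≤ proj₁ p) → ind p ≡ 0
  out (i , v) np with i <? v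
  ... | no q = cong (_* lt s i) (lt-no (ℕP.≮⇒≥ q))
  ... | yes q = trans (cong (lt i v *_) (lt-no (ℕP.≮⇒≥ λ r → np (q , r)))) (ℕP.*-zeroʳ (lt i v))
  go : ∀ xs → ∑ ind (pos (reverse xs)) ≡ rexc s xs
  go []       = refl
  go (x ∷ xs) = trans (cong (∑ ind) (pos-reverse-∷ x xs))
    (trans (∑-++ ind (pos (reverse xs)) _)
      (trans (ℕP.+-comm (∑ ind (pos (reverse xs))) _)
        (cong₂ _+_ (ℕP.+-identityʳ _) (go xs))))

-- The recursion for (exc, den)

Desc : List ℕ → Set
Desc = AllPairs _>_

sel-cong-desc : ∀ A {f g} → Desc A →
  (∀ x r → A ↭ x ∷ r → Desc r → f x r ≡ g x r) → sel A f ≡ sel A g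
sel-cong-desc []      _          eq = refl
sel-cong-desc (x ∷ A) (x> ∷ dA) eq = cong₂ _+_ (eq x A ↭-refl dA)
  (sel-cong-desc A dA λ y r p d → eq y (x ∷ r) (↭-trans (prep x p) (swap x y ↭-refl))
    (All.tail (All-resp-↭ p x>) ∷ d))

∑-all : ∀ {f : ℕ → ℕ} {c} xs → All (λ y → f y ≡ c) xs → ∑ f xs ≡ length xs * c
∑-all []       []       = refl
∑-all (x ∷ xs) (p ∷ ps) = cong₂ _+_ p (∑-all xs ps)

∑-all-0 : ∀ {f : ℕ → ℕ} xs → All (λ y → f y ≡ 0) xs → ∑ f xs ≡ 0
∑-all-0 xs ps = trans (∑-all xs ps) (ℕP.*-zeroʳ (length xs))

∑-all-1 : ∀ {f : ℕ → ℕ} xs → All (λ y → f y ≡ 1) xs → ∑ f xs ≡ length xs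
∑-all-1 xs ps = trans (∑-all xs ps) (ℕP.*-identityʳ (length xs))

if-top : Bool → ℕ → List ℕ
if-top true  x = [ x ]
if-top false x = []

-- The head of w says whether the letter j is present.
low : ∀ {j} → Vec Bool j → List ℕ
low []              = []
low {suc j} (b ∷ w) = if-top b (suc j) ++ low w

length-low : ∀ {j} (w : Vec Bool j) → length (low w) ≡ ones w
length-low []          = refl
length-low (false ∷ w) = length-low w
length-low (true ∷ w)  = cong suc (length-low w)

low≤ : ∀ {j} (w : Vec Bool j) → All (_≤ j) (low w)
low≤ []          = []
low≤ (false ∷ w) = All.map ℕP.m≤n⇒m≤1+n (low≤ w)
low≤ (true ∷ w)  = ℕP.≤-refl ∷ All.map ℕP.m≤n⇒m≤1+n (low≤ w)

low-ones : ∀ n → low (replicate n true) ≡ down n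
low-ones zero    = refl
low-ones (suc n) = cong (suc n ∷_) (low-ones n)

ones-ones : ∀ n → ones (replicate n true) ≡ n
ones-ones zero    = refl
ones-ones (suc n) = cong suc (ones-ones n)

-- For j < x the interval wraps around: it takes in every letter up to j, and among the high letters
-- only those above x.
cyc-high : ∀ x j r L → j < x → All (j <_) r → All (_≤ j) L → cyc x j (r ++ L) ≡ length L + ∑ (lt x) r
cyc-high x j r L j<x hr hL = begin
  lt j x * (∑ (lt x) (r ++ L) + ∑ (λ y → lt y (suc j)) (r ++ L)) + lt x (suc j) * D
    ≡⟨ cong₂ (λ u v → u * (∑ (lt x) (r ++ L) + ∑ (λ y → lt y (suc j)) (r ++ L)) + v * D) (lt-yes j<x) (lt-no j<x) ⟩
  1 * (∑ (lt x) (r ++ L) + ∑ (λ y → lt y (suc j)) (r ++ L)) + 0 * D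
    ≡⟨ cong₂ (λ u v → 1 * (u + v) + 0 * D)
        (trans (∑-++ (lt x) r L) (cong (∑ (lt x) r +_) (∑-all-0 L (All.map (λ y≤j → lt-no (ℕP.≤-trans y≤j (ℕP.<⇒≤ j<x))) hL))))
        (trans (∑-++ (λ y → lt y (suc j)) r L) (cong₂ _+_ (∑-all-0 r (All.map (λ j<y → lt-no j<y) hr)) (∑-all-1 L (All.map (λ y≤j → lt-yes (s≤s y≤j)) hL)))) ⟩
  1 * ((∑ (lt x) r + 0) + (0 + length L)) + 0 * D ≡⟨ lem (∑ (lt x) r) (length L) D ⟩
  length L + ∑ (lt x) r ∎
  where
  D = ∑ (λ y → lt x y * lt y (suc j)) (r ++ L)
  lem : ∀ a l d → 1 * ((a + 0) + (0 + l)) + 0 * d ≡ l + a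
  lem = solve-∀

cyc-low : ∀ x j Hs r → x ≤ j → All (j <_) Hs → All (_≤ j) r → cyc x j (Hs ++ r) ≡ ∑ (lt x) r
cyc-low x j Hs r x≤j hH hr = begin
  lt j x * D + lt x (suc j) * ∑ f (Hs ++ r)
    ≡⟨ cong₂ (λ u v → u * D + v * ∑ f (Hs ++ r)) (lt-no x≤j) (lt-yes (s≤s x≤j)) ⟩
  0 * D + 1 * ∑ f (Hs ++ r) ≡⟨ ℕP.*-identityˡ _ ⟩
  ∑ f (Hs ++ r) ≡⟨ ∑-++ f Hs r ⟩
  ∑ f Hs + ∑ f r ≡⟨ cong₂ _+_ (∑-all-0 Hs (All.map (λ {y} j<y → trans (cong (lt x y *_) (lt-no j<y)) (ℕP.*-zeroʳ (lt x y))) hH))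
      (same r hr) ⟩
  ∑ (lt x) r ∎
  where
  f : ℕ → ℕ
  f y = lt x y * lt y (suc j)
  D = ∑ (lt x) (Hs ++ r) + ∑ (λ y → lt y (suc j)) (Hs ++ r)
  same : ∀ r → All (_≤ j) r → ∑ f r ≡ ∑ (lt x) r
  same []      []       = refl
  same (y ∷ r) (p ∷ ps) = cong₂ _+_ (trans (cong (lt x y *_) (lt-yes (s≤s p))) (ℕP.*-identityʳ (lt x y))) (same r ps)

module _ (q : ℕ) where

  -- In a descending list the letters in front of the chosen one are exactly the larger ones, so the
  -- exponents are 0, 1, 2, and so on.
  sel-high : ∀ Hs c → Desc Hs → sel Hs (λ x r → q ^ ∑ (lt x) r * c) ≡ qnum q (length Hs) * c
  sel-high []       c _          = refl
  sel-high (x ∷ Hs) c (x> ∷ d) = begin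
    q ^ ∑ (lt x) Hs * c + sel Hs (λ y r → q ^ (lt y x + ∑ (lt y) r) * c)
      ≡⟨ cong₂ _+_ (cong (λ t → q ^ t * c) (∑-all-0 Hs (All.map (λ x>y → lt-no (ℕP.<⇒≤ x>y)) x>)))
          (sel-cong Hs λ y r p → trans (cong (λ t → q ^ (t + ∑ (lt y) r) * c) (lt-yes (All.head (All-resp-↭ p x>))))
            (ℕP.*-assoc q _ c)) ⟩
    1 * c + sel Hs (λ y r → q * (q ^ ∑ (lt y) r * c))
      ≡⟨ cong (1 * c +_) (trans (sel-* Hs q _) (cong (q *_) (sel-high Hs c d))) ⟩
    1 * c + q * (qnum q (length Hs) * c) ≡⟨ lem q (qnum q (length Hs)) c ⟩
    (1 + q * qnum q (length Hs)) * c ∎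
    where
    lem : ∀ q a c → 1 * c + q * (a * c) ≡ (1 + q * a) * c
    lem = solve-∀

  sel-low : ∀ {j} (w : Vec Bool j) f →
    sel (low w) (λ y r → q ^ ∑ (lt y) r * f r) ≡ S q (λ v → f (low v)) w
  sel-low []          f = refl
  sel-low (false ∷ w) f = trans (sel-low w f) (sym (ℕP.*-identityˡ _))
  sel-low {suc j} (true ∷ w) f = cong₂ _+_
    (cong (λ t → q ^ t * f (low w)) (∑-all-0 (low w) (All.map (λ p → lt-no (ℕP.m≤n⇒m≤1+n p)) (low≤ w))))
    (begin
      sel (low w) (λ y r → q ^ (lt y (suc j) + ∑ (lt y) r) * f (suc j ∷ r))
        ≡⟨ sel-cong (low w) (λ y r p → trans
            (cong (λ t → q ^ (t + ∑ (lt y) r) * f (suc j ∷ r)) (lt-yes (s≤s (All.head (All-resp-↭ p (low≤ w))))))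
            (lem q (q ^ ∑ (lt y) r) (f (suc j ∷ r)))) ⟩
      sel (low w) (λ y r → q ^ 1 * (q ^ ∑ (lt y) r * f (suc j ∷ r)))
        ≡⟨ trans (sel-* (low w) (q ^ 1) _) (cong (q ^ 1 *_) (sel-low w (λ r → f (suc j ∷ r)))) ⟩
      q ^ 1 * S q (λ v → f (low (true ∷ v))) w ∎)
    where
    lem : ∀ q a c → q * a * c ≡ q * 1 * (a * c)
    lem = solve-∀

  module _ (s : ℕ) where

    denSum : ℕ → List ℕ → (ℕ → ℕ) → ℕ
    denSum j A φ = arr j A (λ τ → φ (rexc s τ) * q ^ code τ)

    -- `cyc` depends only on the set of letters left over, so the power of q for position suc j
    -- comes out of the inner sum.
    denSum-suc : ∀ j A φ → length A ≡ suc j → denSum (suc j) A φ ≡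
      sel A (λ x r → q ^ cyc x (suc j) r * denSum j r (λ k → φ (lt (suc j) x * lt s (suc j) + k)))
    denSum-suc j A φ l = sel-cong A λ x r p → trans
      (arr-cong j r (len p) λ τ τ↭r → trans
        (cong (λ i → φ (lt (suc i) x * lt s (suc i) + rexc s τ) * q ^ (cyc x (suc i) τ + code τ))
          (trans (↭-length τ↭r) (len p)))
        (trans (cong (φ _ *_) (trans (cong (λ t → q ^ (t + code τ)) (cyc-↭ x τ↭r)) (ℕP.^-distribˡ-+-* q (cyc x (suc j) r) (code τ))))
          (lem (φ _) (q ^ cyc x (suc j) r) (q ^ code τ))))
      (arr-* j r (q ^ cyc x (suc j) r) _)
      where
      len : ∀ {x r} → A ↭ x ∷ r → length r ≡ j
      len p = ℕP.suc-injective (trans (sym (↭-length p)) l)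
      cyc-↭ : ∀ x {τ r} → τ ↭ r → cyc x (suc j) τ ≡ cyc x (suc j) r
      cyc-↭ x p rewrite ∑-↭ (lt x) p | ∑-↭ (λ y → lt y (suc (suc j))) p
                      | ∑-↭ (λ y → lt x y * lt y (suc (suc j))) p = refl
      lem : ∀ a b c → a * (b * c) ≡ b * (a * c)
      lem = solve-∀

    -- The letters beyond position j matter only through their number: one value for all choices of
    -- `Hs`. With the quantifier inside, an induction hypothesis also covers high letters enlarged
    -- by a formerly low one.
    Val : ∀ j → Vec Bool j → (ℕ → ℕ) → ℕ → Set
    Val j w φ c = ∀ Hs → Desc Hs → All (j <_) Hs → length Hs + ones w ≡ j → denSum j (Hs ++ low w) φ ≡ c

    -- `c₁`, `c₂` and `F` are the values after a letter beyond position suc j, the letter suc j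
    -- itself and a smaller letter. In the first and the last case the letter suc j, if available,
    -- passes from the low to the high letters. Only the first case can change the weight φ.
    Val-step : ∀ {j} b w φ c₁ c₂ (F : Vec Bool j → ℕ) →
      Val j w (λ k → φ (lt s (suc j) + k)) c₁ →
      (b ≡ true → Val j w φ c₂) →
      (∀ v → suc (ones v) ≡ ones w → Val j v φ (F v)) →
      Val (suc j) (b ∷ w) φ
        (q ^ (bit b + ones w) * qnum q (suc j ∸ (bit b + ones w)) * c₁ + (bit b * c₂ + q ^ bit b * S q F w))
    Val-step {j} b w φ c₁ c₂ F K₁ K₂ K₃ Hs d hi len = begin
      denSum (suc j) (Hs ++ L) φ
        ≡⟨ denSum-suc j (Hs ++ L) φ (trans (length-++ Hs) (trans (cong (length Hs +_) (length-low (b ∷ w))) len)) ⟩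
      sel (Hs ++ L) (λ x r → q ^ cyc x (suc j) r * denSum j r (λ k → φ (lt (suc j) x * lt s (suc j) + k)))
        ≡⟨ sel-++ Hs L _ ⟩
      sel Hs (λ x r → q ^ cyc x (suc j) (r ++ L) * denSum j (r ++ L) (λ k → φ (lt (suc j) x * lt s (suc j) + k)))
      + sel L (λ x r → q ^ cyc x (suc j) (Hs ++ r) * denSum j (Hs ++ r) (λ k → φ (lt (suc j) x * lt s (suc j) + k)))
        ≡⟨ cong₂ _+_ part₁ part₂ ⟩
      q ^ (bit b + ones w) * qnum q (suc j ∸ (bit b + ones w)) * c₁ + (bit b * c₂ + q ^ bit b * S q F w) ∎
      where
      L = low (b ∷ w)
      desc-top : ∀ {r} → Desc r → All (suc j <_) r → Desc (r ++ if-top b (suc j))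
      desc-top dr hr = AllPairsP.++⁺ dr (single b) (All.map (λ p → single' b p) hr)
        where
        single : ∀ b → Desc (if-top b (suc j))
        single true  = [] ∷ []
        single false = []
        single' : ∀ b {x} → suc j < x → All (x >_) (if-top b (suc j))
        single' true  p = p ∷ []
        single' false p = []
      hi-top : ∀ {r} → All (suc j <_) r → All (j <_) (r ++ if-top b (suc j))
      hi-top hr = AllP.++⁺ (All.map ℕP.<⇒≤ hr) (single b)
        where
        single : ∀ b → All (j <_) (if-top b (suc j))
        single true  = ℕP.≤-refl ∷ []
        single false = []
      length-top : ∀ (r : List ℕ) b → length (r ++ if-top b (suc j)) ≡ length r + bit b
      length-top r true  = length-++ r
      length-top r false = length-++ r
      part₁ : sel Hs (λ x r → q ^ cyc x (suc j) (r ++ L) * denSum j (r ++ L) (λ k → φ (lt (suc j) x * lt s (suc j) + k)))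
        ≡ q ^ (bit b + ones w) * qnum q (suc j ∸ (bit b + ones w)) * c₁
      part₁ = begin
        _ ≡⟨ sel-cong-desc Hs d (λ x r p dr → let h = All-resp-↭ p hi in
               trans (cong₂ (λ u v → q ^ u * v)
                 (trans (cyc-high x (suc j) r L (All.head h) (All.tail h) (low≤ (b ∷ w))) (cong (_+ ∑ (lt x) r) (length-low (b ∷ w))))
                 (trans (arr-ext j (r ++ L) (λ τ → cong (λ u → φ (u + rexc s τ) * q ^ code τ)
                      (trans (cong (_* lt s (suc j)) (lt-yes (All.head h))) (ℕP.*-identityˡ _))))
                   (trans (cong (λ A → denSum j A (λ k → φ (lt s (suc j) + k))) (sym (++-assoc r (if-top b (suc j)) (low w))))
                     (K₁ (r ++ if-top b (suc j)) (desc-top dr (All.tail h)) (hi-top (All.tail h))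
                       (trans (cong (_+ ones w) (length-top r b)) (trans (ℕP.+-assoc (length r) (bit b) (ones w))
                         (ℕP.suc-injective (trans (cong (_+ (bit b + ones w)) (sym (↭-length p))) len))))))))
               (trans (cong (_* c₁) (ℕP.^-distribˡ-+-* q (bit b + ones w) _)) (ℕP.*-assoc (q ^ (bit b + ones w)) _ c₁))) ⟩
        sel Hs (λ x r → q ^ (bit b + ones w) * (q ^ ∑ (lt x) r * c₁)) ≡⟨ sel-* Hs (q ^ (bit b + ones w)) _ ⟩
        q ^ (bit b + ones w) * sel Hs (λ x r → q ^ ∑ (lt x) r * c₁) ≡⟨ cong (q ^ (bit b + ones w) *_) (sel-high Hs c₁ d) ⟩
        q ^ (bit b + ones w) * (qnum q (length Hs) * c₁) ≡⟨ ℕP.*-assoc (q ^ (bit b + ones w)) _ c₁ ⟨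
        q ^ (bit b + ones w) * qnum q (length Hs) * c₁
          ≡⟨ cong (λ t → q ^ (bit b + ones w) * qnum q t * c₁)
              (trans (sym (ℕP.m+n∸n≡m (length Hs) (bit b + ones w))) (cong (_∸ (bit b + ones w)) len)) ⟩
        q ^ (bit b + ones w) * qnum q (suc j ∸ (bit b + ones w)) * c₁ ∎
      f : List ℕ → ℕ
      f r = denSum j (Hs ++ r) φ
      head : ∀ b → length Hs + (bit b + ones w) ≡ suc j → (b ≡ true → Val j w φ c₂) → bit b * f (low w) ≡ bit b * c₂
      head false len K = refl
      head true  len K = cong (1 *_) (K refl Hs d (All.map ℕP.<⇒≤ hi)
        (ℕP.suc-injective (trans (sym (ℕP.+-suc (length Hs) (ones w))) len)))
      part₂ : sel L (λ x r → q ^ cyc x (suc j) (Hs ++ r) * denSum j (Hs ++ r) (λ k → φ (lt (suc j) x * lt s (suc j) + k)))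
        ≡ bit b * c₂ + q ^ bit b * S q F w
      part₂ = begin
        _ ≡⟨ sel-cong L (λ x r p → let h = All-resp-↭ p (low≤ (b ∷ w)) in cong₂ (λ u v → q ^ u * v)
               (cyc-low x (suc j) Hs r (All.head h) hi (All.tail h))
               (arr-ext j (Hs ++ r) (λ τ → cong (λ u → φ (u * lt s (suc j) + rexc s τ) * q ^ code τ) (lt-no (All.head h))))) ⟩
        sel L (λ x r → q ^ ∑ (lt x) r * f r) ≡⟨ sel-low (b ∷ w) f ⟩
        bit b * f (low w) + q ^ bit b * S q (λ v → f (low (b ∷ v))) w
          ≡⟨ cong₂ (λ u v → u + q ^ bit b * v) (head b len K₂) (S-cong q w λ v e →
              trans (cong (λ A → denSum j A φ) (sym (++-assoc Hs (if-top b (suc j)) (low v))))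
                (K₃ v e (Hs ++ if-top b (suc j)) (desc-top d hi) (hi-top hi)
                  (trans (cong (_+ ones v) (length-top Hs b)) (trans (ℕP.+-assoc (length Hs) (bit b) (ones v))
                    (ℕP.suc-injective (trans (trans (sym (ℕP.+-suc (length Hs) _))
                      (cong (length Hs +_) (trans (sym (ℕP.+-suc (bit b) (ones v))) (cong (bit b +_) e)))) len)))))) ⟩
        bit b * c₂ + q ^ bit b * S q F w ∎

    -- No position up to s counts towards the excedances, so φ 0 factors out; and [h] + q ^ h
    -- [j - h] = [j] does not depend on how many of the j letters are low.
    Val-small : ∀ j → j ≤ s → ∀ w φ → Val j w φ (qfac q j * φ 0)
    Val-small zero    _   []      φ []       d hi len = trans (ℕP.*-identityʳ (φ 0)) (sym (ℕP.*-identityˡ (φ 0)))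
    Val-small (suc j) j<s (b ∷ w) φ = subst (Val (suc j) (b ∷ w) φ) eq
      (Val-step b w φ c c (λ _ → c)
        (λ Hs d hi len → trans (arr-ext j (Hs ++ low w) λ τ → cong (λ u → φ (u + rexc s τ) * q ^ code τ) (lt-no j<s))
          (Val-small j (ℕP.<⇒≤ j<s) w φ Hs d hi len))
        (λ _ → Val-small j (ℕP.<⇒≤ j<s) w φ)
        (λ v _ → Val-small j (ℕP.<⇒≤ j<s) v φ))
      where
      c = qfac q j * φ 0
      lem : ∀ a b c → a * b * c ≡ a * (b * c)
      lem = solve-∀
      lem' : ∀ b → bit b * c + q ^ bit b * (qnum q (ones w) * c) ≡ qnum q (bit b + ones w) * c
      lem' false = trans (ℕP.*-identityˡ _) refl
      lem' true  = l q (qnum q (ones w)) c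
        where
        l : ∀ q n c → 1 * c + q * 1 * (n * c) ≡ (1 + q * n) * c
        l = solve-∀
      h = bit b + ones w
      eq : q ^ h * qnum q (suc j ∸ h) * c + (bit b * c + q ^ bit b * S q (λ _ → c) w) ≡ qfac q (suc j) * φ 0
      eq = begin
        q ^ h * qnum q (suc j ∸ h) * c + (bit b * c + q ^ bit b * S q (λ _ → c) w)
          ≡⟨ cong (λ t → q ^ h * qnum q (suc j ∸ h) * c + (bit b * c + q ^ bit b * t)) (S-ones q (λ _ → c) w) ⟩
        q ^ h * qnum q (suc j ∸ h) * c + (bit b * c + q ^ bit b * (qnum q (ones w) * c))
          ≡⟨ cong (q ^ h * qnum q (suc j ∸ h) * c +_) (lem' b) ⟩
        q ^ h * qnum q (suc j ∸ h) * c + qnum q h * c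
          ≡⟨ trans (sym (ℕP.*-distribʳ-+ c (q ^ h * qnum q (suc j ∸ h)) (qnum q h))) (cong (_* c) (ℕP.+-comm (q ^ h * qnum q (suc j ∸ h)) (qnum q h))) ⟩
        (qnum q h + q ^ h * qnum q (suc j ∸ h)) * c ≡⟨ cong (_* c) (qnum-+ q h (suc j ∸ h)) ⟨
        qnum q (h + (suc j ∸ h)) * c ≡⟨ cong (λ t → qnum q t * c) (ℕP.m+[n∸m]≡n (ones≤ (b ∷ w))) ⟩
        qnum q (suc j) * (qfac q j * φ 0) ≡⟨ lem (qnum q (suc j)) (qfac q j) (φ 0) ⟨
        qfac q (suc j) * φ 0 ∎

    -- The index shift between φ and ψ is k = m + i - ones w.
    Val-H : ∀ i w φ ψ → (∀ m k → m + i ≡ k + ones w → ψ m ≡ φ k) → Val (i + s) w φ (H q s i w ψ)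
    Val-H zero w φ ψ eq = subst (Val s w φ) (cong (qfac q s *_) (sym (eq (ones w) 0 (ℕP.+-identityʳ (ones w)))))
      (Val-small s ℕP.≤-refl w φ)
    Val-H (suc i) (b ∷ w) φ ψ eq = subst (Val (suc (i + s)) (b ∷ w) φ) (sym (H-rec q s i b w ψ))
      (Val-step b w φ _ _ (λ v → H q s i v (λ m → ψ (bit b + m)))
        -- A letter beyond position suc (i + s) is a counted excedance because that position exceeds
        -- s; this turns k into `suc k`.
        (Val-H i w _ _ λ m k e → trans (eq (bit b + m) (suc k) (e₁ m k e)) (cong (λ u → φ (u + k)) (sym (lt-yes (s≤s (ℕP.m≤n+m s i))))))
        (λ b≡ → Val-H i w φ ψ λ m k e → eq m k (trans (ℕP.+-suc m i) (trans (cong suc e)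
          (trans (sym (ℕP.+-suc k (ones w))) (cong (λ b → k + (bit b + ones w)) (sym b≡))))))
        (λ v e' → Val-H i v φ _ λ m k e → eq (bit b + m) k (e₃ v e' m k e)))
      where
      l₁ : ∀ b m i → b + m + (1 + i) ≡ 1 + b + (m + i)
      l₁ = solve-∀
      l₂ : ∀ b k h → 1 + b + (k + h) ≡ 1 + k + (b + h)
      l₂ = solve-∀
      l₃ : ∀ b k h → 1 + b + (k + h) ≡ k + (b + (1 + h))
      l₃ = solve-∀
      e₁ : ∀ m k → m + i ≡ k + ones w → bit b + m + suc i ≡ suc k + (bit b + ones w)
      e₁ m k e = trans (l₁ (bit b) m i) (trans (cong (λ t → 1 + bit b + t) e) (l₂ (bit b) k (ones w)))
      e₃ : ∀ (v : Vec Bool (i + s)) → suc (ones v) ≡ ones w → ∀ m k → m + i ≡ k + ones v →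
        bit b + m + suc i ≡ k + (bit b + ones w)
      e₃ v e' m k e = trans (l₁ (bit b) m i) (trans (cong (λ t → 1 + bit b + t) e)
        (trans (l₃ (bit b) k (ones v)) (cong (λ t → k + (bit b + t)) e')))

    denSum-down : ∀ i ψ → denSum (i + s) (down (i + s)) (λ k → ψ (s + k)) ≡ H q s i (replicate (i + s) true) ψ
    denSum-down i ψ = trans (cong (λ A → denSum (i + s) A (λ k → ψ (s + k))) (sym (low-ones (i + s))))
      (Val-H i (replicate (i + s) true) _ ψ
        (λ m k e → cong ψ (ℕP.+-cancelʳ-≡ i m (s + k) (trans e (trans (cong (k +_) (ones-ones (i + s))) (l k i s)))))
        [] [] [] (ones-ones (i + s)))
      where
      l : ∀ k i s → k + (i + s) ≡ s + k + i
      l = solve-∀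

    denSum-small : ∀ j φ → j ≤ s → denSum j (down j) φ ≡ qfac q j * φ 0
    denSum-small j φ j≤s = trans (cong (λ A → denSum j A φ) (sym (low-ones j)))
      (Val-small j j≤s (replicate j true) φ [] [] [] (ones-ones j))

-- The recursion for (rdes, rmaj)

ins-cong : ∀ a w {F G} → (∀ v → v ↭ a ∷ w → F v ≡ G v) → ins a w F ≡ ins a w G
ins-cong a []      eq = eq [ a ] ↭-refl
ins-cong a (x ∷ w) eq = cong₂ _+_ (eq _ ↭-refl)
  (ins-cong a w λ v p → eq (x ∷ v) (↭-trans (prep x p) (swap x a ↭-refl)))

module _ (r : ℕ) where

  descent : ℕ → List ℕ → ℕ
  descent x []      = 0
  descent x (y ∷ w) = lt (y + r) (suc x)

  -- Prepending a letter moves every r-descent one place to the right, so `maj` grows by the number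
  -- of r-descents of the longer word.
  des maj sinv : List ℕ → ℕ
  des []       = 0
  des (x ∷ w)  = descent x w + des w
  maj []       = 0
  maj (x ∷ w)  = (descent x w + des w) + maj w
  sinv []      = 0
  sinv (x ∷ w) = ∑ (λ y → lt y x * lt x (y + r)) w + sinv w

  interval : ℕ → ℕ → List ℕ
  interval o zero    = []
  interval o (suc n) = suc o ∷ interval (suc o) n

  range≡interval : ∀ n → range n ≡ interval 0 n
  range≡interval n = trans (map-upTo suc n) (go n suc 0 λ _ → refl)
    where
    go : ∀ n f o → (∀ k → f k ≡ suc (o + k)) → applyUpTo f n ≡ interval o n
    go zero    f o eq = refl
    go (suc n) f o eq = cong₂ _∷_ (trans (eq 0) (cong suc (ℕP.+-identityʳ o)))
      (go n (λ k → f (suc k)) (suc o) λ k → trans (eq (suc k)) (cong suc (ℕP.+-suc o k)))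

  private
    desInd : ℕ × ℕ × ℕ → ℕ
    desInd (_ , x , y) = lt (y + r) (suc x)

    des? : (t : ℕ × ℕ × ℕ) → Dec (proj₂ (proj₂ t) + r ≤ proj₁ (proj₂ t))
    des? t = proj₂ (proj₂ t) + r ≤? proj₁ (proj₂ t)

    triples : ℕ → List ℕ → List (ℕ × ℕ × ℕ)
    triples o w = zip (interval o (length w)) (zip w (drop 1 w))

    des-triples : ∀ o w → ∑ desInd (triples o w) ≡ des w
    des-triples o []          = refl
    des-triples o (x ∷ [])    = refl
    des-triples o (x ∷ y ∷ w) = cong (lt (y + r) (suc x) +_) (des-triples (suc o) (y ∷ w))

    maj-triples : ∀ o w → ∑ (λ t → desInd t * proj₁ t) (triples o w) ≡ maj w + o * des w
    maj-triples o []          = sym (ℕP.*-zeroʳ o)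
    maj-triples o (x ∷ [])    = sym (ℕP.*-zeroʳ o)
    maj-triples o (x ∷ y ∷ w) = trans (cong (lt (y + r) (suc x) * suc o +_) (maj-triples (suc o) (y ∷ w)))
      (lem (lt (y + r) (suc x)) o (maj (y ∷ w)) (des (y ∷ w)))
      where
      lem : ∀ d o m e → d * (1 + o) + (m + (1 + o) * e) ≡ ((d + e) + m) + o * (d + e)
      lem = solve-∀

    rDes-triples : ∀ w → rDes r w ≡ map (λ t → proj₁ t) (filter des? (triples 0 w))
    rDes-triples w = cong (λ l → map (λ t → proj₁ t) (filter des? (zip l (zip w (drop 1 w))))) (range≡interval (length w))

    smallInv≡sinv : ∀ w → smallInv r w ≡ sinv w
    smallInv≡sinv []      = refl
    smallInv≡sinv (x ∷ w) = cong₂ _+_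
      (length-filter-∑ (λ y → (y <? x) ×-dec (x <? y + r)) _ w
        (λ y (p , p') → cong₂ _*_ (lt-yes p) (lt-yes p')) out)
      (smallInv≡sinv w)
      where
      out : ∀ y → ¬ (y < x × x < y + r) → lt y x * lt x (y + r) ≡ 0
      out y np with ℕP.<-≤-connex y x
      ... | inj₂ p = cong (_* lt x (y + r)) (lt-no p)
      ... | inj₁ p = trans (cong (lt y x *_) (lt-no (ℕP.≮⇒≥ λ p' → np (p , p')))) (ℕP.*-zeroʳ (lt y x))

  rdes≡des : ∀ w → rdes r w ≡ des w
  rdes≡des w = trans (cong length (rDes-triples w)) (trans (length-map _ (filter des? (triples 0 w)))
    (trans (length-filter-∑ des? desInd (triples 0 w) (λ _ p → lt-yes (s≤s p)) (λ _ p → lt-no (ℕP.≰⇒> p)))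
      (des-triples 0 w)))

  rmaj≡maj : ∀ w → rmaj r w ≡ maj w + sinv w
  rmaj≡maj w = cong₂ _+_ (trans (cong sum (rDes-triples w))
    (trans (∑-filter des? desInd proj₁ (triples 0 w) (λ _ p → lt-yes (s≤s p)) (λ _ p → lt-no (ℕP.≰⇒> p)))
      (trans (maj-triples 0 w) (ℕP.+-identityʳ (maj w)))))
    (smallInv≡sinv w)

  module _ (q : ℕ) where

    weight : (ℕ → ℕ) → List ℕ → ℕ
    weight φ w = φ (des w) * q ^ (maj w + sinv w)

    module _ (a : ℕ) where

      -- Counts the letters in front of which `a` creates no r-descent. If `a` exceeds all letters,
      -- they are also those that form a small inversion with an `a` to their left.
      large : List ℕ → ℕ
      large w = ∑ (λ y → lt a (y + r)) w

      small-below : ∀ w → All (_< a) w → ∑ (λ y → lt y a * lt a (y + r)) w ≡ large w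
      small-below []      []       = refl
      small-below (y ∷ w) (p ∷ ps) = cong₂ _+_ (trans (cong (_* lt a (y + r)) (lt-yes p)) (ℕP.*-identityˡ _))
        (small-below w ps)

      private
        -- Prepending x raises the exponents of the places that create an r-descent by one more than
        -- the others. Behind the run 0, ..., t this leaves both 1 + t and 2 + t free; a place
        -- between x and y that keeps the number of r-descents takes 1 + t.
        absorb : ∀ M u t n n' Z A B E → E ≡ M + u + (1 + t) → n' ≡ n + q ^ (1 + t) →
          A * q ^ E + q ^ M * (n * (A * q ^ u) + q ^ (2 + t) * Z * (B * q ^ (1 + u)))
          ≡ q ^ (M + u) * (n' * A + q ^ (3 + t) * Z * B)
        absorb M u t n n' Z A B E refl refl
          rewrite ℕP.^-distribˡ-+-* q (M + u) (1 + t) | ℕP.^-distribˡ-+-* q M u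
          = lem q (q ^ M) (q ^ u) (q ^ t) n Z A B
          where
          lem : ∀ q M u t n Z A B → A * (M * u * (q * t)) + M * (n * (A * u) + q * (q * t) * Z * (B * (q * u)))
            ≡ M * u * ((n + q * t) * A + q * (q * (q * t)) * Z * B)
          lem = solve-∀

        -- The other outcome: a place between x and y that creates an r-descent takes 2 + t, at the
        -- front of the second run.
        extend : ∀ M u t n Z A B E → E ≡ M + u + (2 + t) →
          B * q ^ E + q ^ M * (n * (A * q ^ u) + q ^ (2 + t) * Z * (B * q ^ (1 + u)))
          ≡ q ^ (M + u) * (n * A + q ^ (2 + t) * (1 + q * Z) * B)
        extend M u t n Z A B E refl
          rewrite ℕP.^-distribˡ-+-* q (M + u) (2 + t) | ℕP.^-distribˡ-+-* q M u
          = lem q (q ^ M) (q ^ u) (q ^ t) n Z A B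
          where
          lem : ∀ q M u t n Z A B → B * (M * u * (q * (q * t))) + M * (n * (A * u) + q * (q * t) * Z * (B * (q * u)))
            ≡ M * u * (n * A + q * (q * t) * (1 + q * Z) * B)
          lem = solve-∀

      -- With t = `large w + des (x ∷ w)`, the exponent 1 + t is left out between the two runs. It
      -- is reserved for the place in front of x, which this sum does not contain.
      Rest : ℕ → List ℕ → ℕ → Set
      Rest x w z = ∀ φ → ins a w (λ v → weight φ (x ∷ v)) ≡
        q ^ (maj (x ∷ w) + sinv (x ∷ w)) *
          (qnum q (1 + (large w + des (x ∷ w))) * φ (des (x ∷ w))
           + q ^ (2 + (large w + des (x ∷ w))) * qnum q z * φ (1 + des (x ∷ w)))

      -- The places before a large letter, inside an r-descent and at the end are those that keep
      -- the number of r-descents.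
      insert-rest : ∀ x w → x < a → All (_< a) w →
        Σ ℕ λ z → length w ≡ (large w + des (x ∷ w)) + z × Rest x w z
      insert-rest x []       x<a []         = 0 , refl , base
        where
        base : Rest x [] 0
        base φ rewrite lt-no {a + r} {suc x} (ℕP.≤-trans x<a (ℕP.m≤m+n a r)) | lt-no {a} {x} (ℕP.<⇒≤ x<a)
          = lem q (φ 0) (φ 1)
          where
          lem : ∀ q c d → c * 1 ≡ 1 * ((1 + q * 0) * c + q * (q * 1) * 0 * d)
          lem = solve-∀
      insert-rest x (y ∷ w) x<a (y<a ∷ w<a) with insert-rest y w y<a w<a
      ... | z , len , ih = go (ℕP.<-≤-connex a (y + r)) (ℕP.<-≤-connex x (y + r))
        where
        k M s B : ℕ
        k = des (y ∷ w)
        M = maj (y ∷ w) + sinv (y ∷ w)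
        s = ∑ (λ z → lt z x * lt x (z + r)) (y ∷ w)
        B = large w
        δ = lt (y + r) (suc x)
        ν = lt (y + r) (suc a)
        β = lt a (y + r)

        first : ∀ φ → weight φ (x ∷ a ∷ y ∷ w) ≡
          φ (ν + k) * q ^ (((ν + k) + ((ν + k) + maj (y ∷ w))) + (s + ((β + B) + sinv (y ∷ w))))
        first φ rewrite lt-no {a + r} {suc x} (ℕP.≤-trans x<a (ℕP.m≤m+n a r)) | lt-no {a} {x} (ℕP.<⇒≤ x<a)
                      | small-below (y ∷ w) (y<a ∷ w<a) = refl

        others : ∀ φ → ins a w (λ v → weight φ (x ∷ y ∷ v)) ≡
          q ^ M * (qnum q (1 + (B + k)) * (φ (δ + k) * q ^ (δ + k + s))
           + q ^ (2 + (B + k)) * qnum q z * (φ (δ + (1 + k)) * q ^ (δ + (1 + k) + s)))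
        -- Since x < a, the inserted letter adds no small inversion with x; prepending x only
        -- replaces the weight by another function of the number of r-descents.
        others φ = trans (ins-cong a w step) (ih (λ k → φ (δ + k) * q ^ (δ + k + s)))
          where
          step : ∀ v → v ↭ a ∷ w → weight φ (x ∷ y ∷ v) ≡ weight (λ k → φ (δ + k) * q ^ (δ + k + s)) (y ∷ v)
          step v p = trans (cong (λ t → φ (δ + des (y ∷ v)) * q ^ t)
              (trans (cong (λ t → (δ + des (y ∷ v) + maj (y ∷ v)) + (lt y x * lt x (y + r) + t + sinv (y ∷ v)))
                (trans (∑-↭ (λ z → lt z x * lt x (z + r)) p)
                  (cong (λ t → t * lt x (a + r) + ∑ (λ z → lt z x * lt x (z + r)) w) (lt-no (ℕP.<⇒≤ x<a)))))
              (l (δ + des (y ∷ v)) (maj (y ∷ v)) s (sinv (y ∷ v)))))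
            (trans (cong (φ (δ + des (y ∷ v)) *_) (ℕP.^-distribˡ-+-* q (δ + des (y ∷ v) + s) _))
              (sym (ℕP.*-assoc (φ (δ + des (y ∷ v))) _ _)))
            where
            l : ∀ d m s i → (d + m) + (s + i) ≡ (d + s) + (m + i)
            l = solve-∀

        e₀ : ∀ k m s B i → ((0 + k) + ((0 + k) + m)) + (s + ((1 + B) + i)) ≡ (m + i) + (0 + k + s) + (1 + (B + k))
        e₀ = solve-∀
        e₁ : ∀ k m s B i → ((1 + k) + ((1 + k) + m)) + (s + ((0 + B) + i)) ≡ (m + i) + (1 + k + s) + (1 + (B + k))
        e₁ = solve-∀
        e₂ : ∀ k m s B i → ((1 + k) + ((1 + k) + m)) + (s + ((0 + B) + i)) ≡ (m + i) + (0 + k + s) + (2 + (B + k))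
        e₂ = solve-∀
        eM : ∀ d k m s i → (d + k + m) + (s + i) ≡ (m + i) + (d + k + s)
        eM = solve-∀

        before others-sum : ℕ → ℕ → (ℕ → ℕ) → ℕ
        before ν β φ = φ (ν + k) * q ^ (((ν + k) + ((ν + k) + maj (y ∷ w))) + (s + ((β + B) + sinv (y ∷ w))))
        others-sum δ n φ = q ^ M * (n * (φ (δ + k) * q ^ (δ + k + s))
           + q ^ (2 + (B + k)) * qnum q z * (φ (δ + (1 + k)) * q ^ (δ + (1 + k) + s)))

        target : ℕ → ℕ → ℕ → ℕ → (ℕ → ℕ) → ℕ
        target e t d z φ = q ^ e * (qnum q (1 + t) * φ d + q ^ (2 + t) * qnum q z * φ (1 + d))

        N : ℕ
        N = qnum q (1 + (B + k))

        Goal : ℕ → ℕ → ℕ → Set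
        Goal δ β z = suc (length w) ≡ ((β + B) + (δ + k)) + z × (∀ φ →
          ins a (y ∷ w) (λ v → weight φ (x ∷ v)) ≡
          target ((δ + k + maj (y ∷ w)) + (s + sinv (y ∷ w))) ((β + B) + (δ + k)) (δ + k) z φ)

        finish : ∀ δ' ν' β' z' t → δ ≡ δ' → ν ≡ ν' → β ≡ β' → t ≡ (β' + B) + (δ' + k) →
          suc (length w) ≡ ((β' + B) + (δ' + k)) + z' →
          (∀ φ → before ν' β' φ + others-sum δ' N φ ≡ target (M + (δ' + k + s)) t (δ' + k) z' φ) →
          Σ ℕ (Goal δ β)
        finish δ' ν' β' z' t eδ eν eβ et len' calc =
          z' , subst₂ (λ d b → Goal d b z') (sym eδ) (sym eβ) (len' , λ φ →
            trans (cong₂ _+_ (trans (first φ) (cong₂ (λ n b → before n b φ) eν eβ))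
                             (trans (others φ) (cong (λ d → others-sum d N φ) eδ)))
              (trans (calc φ) (cong₂ (λ e u → target e u (δ' + k) z' φ)
                (sym (eM δ' k (maj (y ∷ w)) s (sinv (y ∷ w)))) et)))

        go : a < y + r ⊎ y + r ≤ a → x < y + r ⊎ y + r ≤ x → Σ ℕ (Goal δ β)
        go (inj₁ p) _ = finish 0 0 1 z (1 + (B + k)) (lt-no (ℕP.<-trans x<a p)) (lt-no p) (lt-yes p) refl (cong suc len)
          λ φ → absorb M (0 + k + s) (B + k) N _ (qnum q z) (φ k) (φ (1 + k)) _
            (e₀ k (maj (y ∷ w)) s B (sinv (y ∷ w))) (qnum-suc q (1 + (B + k)))
        go (inj₂ p) (inj₂ p') = finish 1 1 0 z (1 + (B + k)) (lt-yes (s≤s p')) (lt-yes (s≤s p)) (lt-no p)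
          (sym (ℕP.+-suc B k)) (trans (cong suc len) (cong (_+ z) (sym (ℕP.+-suc B k))))
          λ φ → absorb M (1 + k + s) (B + k) N _ (qnum q z) (φ (1 + k)) (φ (2 + k)) _
            (e₁ k (maj (y ∷ w)) s B (sinv (y ∷ w))) (qnum-suc q (1 + (B + k)))
        go (inj₂ p) (inj₁ p') = finish 0 1 0 (suc z) (B + k) (lt-no p') (lt-yes (s≤s p)) (lt-no p) refl
          (trans (cong suc len) (sym (ℕP.+-suc (B + k) z)))
          λ φ → extend M (0 + k + s) (B + k) N (qnum q z) (φ k) (φ (1 + k)) _
            (e₂ k (maj (y ∷ w)) s B (sinv (y ∷ w)))

      insert-max : ∀ w → All (_< a) w → Σ ℕ λ z → length w ≡ (large w + des w) + z ×
        (∀ φ → ins a w (weight φ) ≡ q ^ (maj w + sinv w) *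
          (qnum q (1 + (large w + des w)) * φ (des w)
           + q ^ (1 + (large w + des w)) * qnum q z * φ (1 + des w)))
      insert-max []      _            = 0 , refl , λ φ → lem q (φ 0) (φ 1)
        where
        lem : ∀ q c d → c * 1 ≡ 1 * ((1 + q * 0) * c + q * 1 * 0 * d)
        lem = solve-∀
      insert-max (x ∷ w) (x<a ∷ w<a) with insert-rest x w x<a w<a
      -- The place in front of x has the reserved exponent 1 + (B + k) in either case; comparing a
      -- with x + r only decides which run it joins.
      ... | z , len , rest = go (ℕP.<-≤-connex a (x + r))
        where
        k M B : ℕ
        k = des (x ∷ w)
        M = maj (x ∷ w) + sinv (x ∷ w)
        B = large w
        ν = lt (x + r) (suc a)
        β = lt a (x + r)

        first : ∀ φ → weight φ (a ∷ x ∷ w) ≡ φ (ν + k) * q ^ (((ν + k) + maj (x ∷ w)) + ((β + B) + sinv (x ∷ w)))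
        first φ rewrite small-below (x ∷ w) (x<a ∷ w<a) = refl

        e₀ : ∀ k m B i → ((0 + k) + m) + ((1 + B) + i) ≡ (m + i) + (1 + (B + k))
        e₀ = solve-∀
        e₁ : ∀ k m B i → ((1 + k) + m) + ((0 + B) + i) ≡ (m + i) + (1 + (B + k))
        e₁ = solve-∀

        before : ℕ → ℕ → (ℕ → ℕ) → ℕ
        before ν β φ = φ (ν + k) * q ^ (((ν + k) + maj (x ∷ w)) + ((β + B) + sinv (x ∷ w)))

        target : ℕ → ℕ → (ℕ → ℕ) → ℕ
        target t z φ = q ^ M * (qnum q (1 + t) * φ k + q ^ (1 + t) * qnum q z * φ (1 + k))

        N : ℕ
        N = qnum q (1 + (B + k))

        rest-sum : (ℕ → ℕ) → ℕ
        rest-sum φ = q ^ M * (N * φ k + q ^ (2 + (B + k)) * qnum q z * φ (1 + k))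

        Goal : ℕ → ℕ → Set
        Goal β z = suc (length w) ≡ ((β + B) + k) + z × (∀ φ →
          ins a (x ∷ w) (weight φ) ≡ target ((β + B) + k) z φ)

        finish : ∀ ν' β' z' → ν ≡ ν' → β ≡ β' → suc (length w) ≡ ((β' + B) + k) + z' →
          (∀ φ → before ν' β' φ + rest-sum φ ≡ target ((β' + B) + k) z' φ) → Σ ℕ (Goal β)
        finish ν' β' z' eν eβ len' calc = z' , subst (λ b → Goal b z') (sym eβ) (len' , λ φ →
          trans (cong₂ _+_ (trans (first φ) (cong₂ (λ n b → before n b φ) eν eβ)) (rest φ)) (calc φ))

        go : a < x + r ⊎ x + r ≤ a → Σ ℕ (Goal β)
        go (inj₁ p) = finish 0 1 z (lt-no p) (lt-yes p) (cong suc len) λ φ →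
            trans (cong (λ u → φ k * u + rest-sum φ)
                (trans (cong (q ^_) (e₀ k (maj (x ∷ w)) B (sinv (x ∷ w)))) (ℕP.^-distribˡ-+-* q M (1 + (B + k)))))
              (trans (lem q (q ^ M) (q ^ (B + k)) N (qnum q z) (φ k) (φ (1 + k)))
                (cong (λ n → q ^ M * (n * φ k + q ^ (2 + (B + k)) * qnum q z * φ (1 + k))) (sym (qnum-suc q (1 + (B + k))))))
          where
          lem : ∀ q M t n Z A B → A * (M * (q * t)) + M * (n * A + q * (q * t) * Z * B)
            ≡ M * ((n + q * t) * A + q * (q * t) * Z * B)
          lem = solve-∀
        go (inj₂ p) = finish 1 0 (suc z) (lt-yes (s≤s p)) (lt-no p)
            (trans (cong suc len) (sym (ℕP.+-suc (B + k) z))) λ φ →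
            trans (cong (λ u → φ (1 + k) * u + rest-sum φ)
                (trans (cong (q ^_) (e₁ k (maj (x ∷ w)) B (sinv (x ∷ w)))) (ℕP.^-distribˡ-+-* q M (1 + (B + k)))))
              (lem q (q ^ M) (q ^ (B + k)) N (qnum q z) (φ k) (φ (1 + k)))
          where
          lem : ∀ q M t n Z A B → B * (M * (q * t)) + M * (n * A + q * (q * t) * Z * B)
            ≡ M * (n * A + q * t * (1 + q * Z) * B)
          lem = solve-∀

-- Comparison of the two recursions

∑-large-down : ∀ i s → ∑ (lt i) (down (i + s)) ≡ s
∑-large-down i s = trans (cong (λ n → ∑ (lt i) (down n)) (ℕP.+-comm i s)) (go s)
  where
  none : ∀ j → j ≤ i → ∑ (lt i) (down j) ≡ 0
  none zero    _   = refl
  none (suc j) j<i = cong₂ _+_ (lt-no j<i) (none j (ℕP.<⇒≤ j<i))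
  go : ∀ s → ∑ (lt i) (down (s + i)) ≡ s
  go zero    = none i ℕP.≤-refl
  go (suc s) = cong₂ _+_ (lt-yes (s≤s (ℕP.m≤n+m i s))) (go s)

lt-+ : ∀ i y s → lt (i + s) (y + s) ≡ lt i y
lt-+ i y zero    = cong₂ lt (ℕP.+-identityʳ i) (ℕP.+-identityʳ y)
lt-+ i y (suc s) = trans (cong₂ lt (ℕP.+-suc i s) (ℕP.+-suc y s)) (lt-+ i y s)

down< : ∀ n → All (_< suc n) (down n)
down< zero    = []
down< (suc n) = ℕP.≤-refl ∷ All.map ℕP.m≤n⇒m≤1+n (down< n)

module _ (q s : ℕ) where

  rmajSum : ℕ → (ℕ → ℕ) → ℕ
  rmajSum n φ = arr n (down n) (weight (suc s) q φ)

  -- The number B of large letters is the same for every arrangement, so inserting the largest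
  -- letter amounts to a fixed change of weight from φ to φ'.
  rmajSum-suc : ∀ n φ B φ' → ∑ (λ y → lt (suc n) (y + suc s)) (down n) ≡ B →
    (∀ k z → n ≡ (B + k) + z → qnum q (1 + (B + k)) * φ k + q ^ (1 + (B + k)) * qnum q z * φ (1 + k) ≡ φ' k) →
    rmajSum (suc n) φ ≡ rmajSum n φ'
  rmajSum-suc n φ B φ' B≡ eq = trans (arr-ins n (suc n) (down n) _ (length-down n))
    (arr-cong n (down n) (length-down n) step)
    where
    step : ∀ w → w ↭ down n → ins (suc n) w (weight (suc s) q φ) ≡ weight (suc s) q φ' w
    step w p with insert-max (suc s) q (suc n) w (All-resp-↭ (↭-sym p) (down< n))
    ... | z , len , val = trans (val φ) (trans
        (cong (q ^ (maj (suc s) w + sinv (suc s) w) *_)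
          (trans (cong (λ B → qnum q (1 + (B + k)) * φ k + q ^ (1 + (B + k)) * qnum q z * φ (1 + k)) large≡)
            (eq k z (trans (sym (trans (↭-length p) (length-down n))) (trans len (cong (λ B → B + k + z) large≡))))))
        (ℕP.*-comm _ (φ' k)))
      where
      k = des (suc s) w
      large≡ : large (suc s) q (suc n) w ≡ B
      large≡ = trans (∑-↭ _ p) B≡

  -- All letters are large here, and the length equation of `insert-max` then forces k = z = 0: only
  -- the first run is left.
  rmajSum-small : ∀ n φ → n ≤ s → rmajSum n φ ≡ qfac q n * φ 0
  rmajSum-small zero    φ _   = trans (ℕP.*-identityʳ (φ 0)) (sym (ℕP.*-identityˡ (φ 0)))
  rmajSum-small (suc n) φ n<s = begin
    rmajSum (suc n) φ
      ≡⟨ rmajSum-suc n φ n (λ _ → qnum q (suc n) * φ 0) (all-large n ℕP.≤-refl) (λ k z e → step k z (zeros k z e)) ⟩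
    rmajSum n (λ _ → qnum q (suc n) * φ 0) ≡⟨ rmajSum-small n (λ _ → qnum q (suc n) * φ 0) (ℕP.<⇒≤ n<s) ⟩
    qfac q n * (qnum q (suc n) * φ 0) ≡⟨ lem (qfac q n) (qnum q (suc n)) (φ 0) ⟩
    qnum q (suc n) * qfac q n * φ 0 ∎
    where
    lem : ∀ a b c → a * (b * c) ≡ b * a * c
    lem = solve-∀
    all-large : ∀ m → m ≤ n → ∑ (λ y → lt (suc n) (y + suc s)) (down m) ≡ m
    all-large zero    _ = refl
    all-large (suc m) l = cong₂ _+_ (lt-yes (s≤s (ℕP.≤-trans (ℕP.≤-trans n<s (ℕP.n≤1+n s)) (ℕP.m≤n+m (suc s) m))))
      (all-large m (ℕP.<⇒≤ l))
    zeros : ∀ k z → n ≡ (n + k) + z → k ≡ 0 × z ≡ 0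
    zeros k z e = ℕP.m+n≡0⇒m≡0 k kz , ℕP.m+n≡0⇒n≡0 k kz
      where
      kz : k + z ≡ 0
      kz = ℕP.+-cancelˡ-≡ n (k + z) 0 (trans (sym (ℕP.+-assoc n k z)) (trans (sym e) (sym (ℕP.+-identityʳ n))))
    step : ∀ k z → k ≡ 0 × z ≡ 0 →
      qnum q (1 + (n + k)) * φ k + q ^ (1 + (n + k)) * qnum q z * φ (1 + k) ≡ qnum q (suc n) * φ 0
    step _ _ (refl , refl) = trans (cong (λ n' → qnum q (1 + n') * φ 0 + q ^ (1 + n') * 0 * φ 1) (ℕP.+-identityʳ n))
      (l (qnum q (1 + n) * φ 0) (q ^ (1 + n)) (φ 1))
      where
      l : ∀ a p b → a + p * 0 * b ≡ a
      l = solve-∀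

  -- With the top letter present, the defining clause of `H` is the insertion recursion in the
  -- argument s + k, where s is the number of large letters.
  rmajSum-down : ∀ i ψ → rmajSum (i + s) (λ k → ψ (s + k)) ≡ H q s i (replicate (i + s) true) ψ
  rmajSum-down zero ψ = trans (rmajSum-small s (λ k → ψ (s + k)) ℕP.≤-refl)
    (cong (λ t → qfac q s * ψ t) (trans (ℕP.+-identityʳ s) (sym (ones-ones s))))
  rmajSum-down (suc i) ψ = trans
    (rmajSum-suc (i + s) _ s (λ k → Ψ q (suc (i + s)) ψ (suc (s + k)))
      (trans (∑-cong (down (i + s)) λ y → trans (cong (lt (suc (i + s))) (ℕP.+-suc y s)) (lt-+ i y s)) (∑-large-down i s))
      λ k z e → cong₂ (λ u v → qnum q (suc (s + k)) * ψ (s + k) + q ^ suc (s + k) * qnum q u * ψ v)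
        (trans (sym (ℕP.m+n∸m≡n (s + k) z)) (cong (_∸ (s + k)) (sym e))) (ℕP.+-suc s k))
    (rmajSum-down i (λ m → Ψ q (suc (i + s)) ψ (suc m)))

  denSum≡rmajSum : ∀ n φ → denSum q s n (down n) φ ≡ rmajSum n φ
  denSum≡rmajSum n φ with ℕP.≤-total n s
  ... | inj₁ n≤s = trans (denSum-small q s n φ n≤s) (sym (rmajSum-small n φ n≤s))
  ... | inj₂ s≤n with n ∸ s | ℕP.m∸n+n≡m s≤n
  ... | i | refl = begin
    -- Every φ has the form ψ (s + k), with ψ m = φ (m ∸ s).
    denSum q s (i + s) (down (i + s)) φ  ≡⟨ arr-ext (i + s) (down (i + s)) (λ τ → cong (_* q ^ code τ) (shifted (rexc s τ))) ⟩
    denSum q s (i + s) (down (i + s)) (λ k → φ (s + k ∸ s)) ≡⟨ denSum-down q s i (λ m → φ (m ∸ s)) ⟩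
    H q s i (replicate (i + s) true) (λ m → φ (m ∸ s)) ≡⟨ rmajSum-down i (λ m → φ (m ∸ s)) ⟨
    rmajSum (i + s) (λ k → φ (s + k ∸ s))
      ≡⟨ arr-ext (i + s) (down (i + s)) (λ w → cong (_* q ^ (maj (suc s) w + sinv (suc s) w)) (shifted (des (suc s) w))) ⟨
    rmajSum (i + s) φ ∎
    where
    shifted : ∀ k → φ k ≡ φ (s + k ∸ s)
    shifted k = cong φ (sym (ℕP.m+n∸m≡n s k))

-- From generating functions to counts

wordSum : ℕ → List ℕ → (List ℕ → ℕ) → ℕ
wordSum zero    A F = F []
wordSum (suc k) A F = ∑ (λ x → wordSum k A (λ w → F (x ∷ w))) A

∑-concatMap : ∀ {A B : Set} (F : B → ℕ) (g : A → List B) xs → ∑ F (concatMap g xs) ≡ ∑ (λ x → ∑ F (g x)) xs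
∑-concatMap F g []       = refl
∑-concatMap F g (x ∷ xs) = trans (∑-++ F (g x) (concatMap g xs)) (cong (∑ F (g x) +_) (∑-concatMap F g xs))

∑-words : ∀ k n F → ∑ F (words k n) ≡ wordSum k (range n) F
∑-words zero    n F = ℕP.+-identityʳ (F [])
∑-words (suc k) n F = trans (∑-concatMap F _ (range n)) (∑-cong (range n) λ x →
  trans (cong sum (sym (map-∘ (words k n)))) (∑-words k n (λ w → F (x ∷ w))))

wordSum-cong : ∀ k {P : ℕ → Set} A {F G} → All P A → (∀ w → All P w → F w ≡ G w) → wordSum k A F ≡ wordSum k A G
wordSum-cong zero    A hA eq = eq [] []
wordSum-cong (suc k) {P} A {F} {G} hA eq = go A hA
  where
  go : ∀ B → All P B → ∑ (λ x → wordSum k A (λ w → F (x ∷ w))) B ≡ ∑ (λ x → wordSum k A (λ w → G (x ∷ w))) B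
  go []      []       = refl
  go (x ∷ B) (p ∷ hB) = cong₂ _+_ (wordSum-cong k A hA λ w hw → eq (x ∷ w) (p ∷ hw)) (go B hB)

wordSum-↭ : ∀ k {A B} F → A ↭ B → wordSum k A F ≡ wordSum k B F
wordSum-↭ zero    F p = refl
wordSum-↭ (suc k) {A} F p = trans (∑-cong A λ x → wordSum-↭ k (λ w → F (x ∷ w)) p) (∑-↭ _ p)

wordSum-0 : ∀ k A F → (∀ w → F w ≡ 0) → wordSum k A F ≡ 0
wordSum-0 zero    A F eq = eq []
wordSum-0 (suc k) A F eq = trans (∑-cong A λ x → wordSum-0 k A _ λ w → eq (x ∷ w)) (zeros A)
  where
  zeros : ∀ (B : List ℕ) → ∑ (λ _ → 0) B ≡ 0
  zeros []      = refl
  zeros (_ ∷ B) = zeros B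

wordSum-absent : ∀ k x r F → (∀ w → x ∈ w → F w ≡ 0) → wordSum k (x ∷ r) F ≡ wordSum k r F
wordSum-absent zero    x r F eq = refl
wordSum-absent (suc k) x r F eq = cong₂ _+_
  (wordSum-0 k (x ∷ r) _ λ w → eq (x ∷ w) (here refl))
  (∑-cong r λ y → wordSum-absent k x r _ λ w x∈w → eq (y ∷ w) (there x∈w))

uniq : List ℕ → ℕ
uniq w = if does (unique? w) then 1 else 0

uniq-yes : ∀ w → Unique w → uniq w ≡ 1
uniq-yes w u with unique? w
... | yes _ = refl
... | no ¬u = contradiction u ¬u

uniq-no : ∀ w → ¬ Unique w → uniq w ≡ 0
uniq-no w ¬u with unique? w
... | yes u = contradiction u ¬u
... | no _  = refl

uniq-∷ : ∀ x w → All (x ≢_) w → uniq (x ∷ w) ≡ uniq w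
uniq-∷ x w h = go (unique? w)
  where
  go : Dec (Unique w) → uniq (x ∷ w) ≡ uniq w
  go (yes u) = trans (uniq-yes (x ∷ w) (h ∷ u)) (sym (uniq-yes w u))
  go (no ¬u) = trans (uniq-no (x ∷ w) λ { (_ ∷ u) → ¬u u }) (sym (uniq-no w ¬u))

-- Words that repeat the first letter x have weight 0, so behind x the alphabet shrinks from A to
-- the remainder r.
wordSum-arr : ∀ k A F → Unique A → wordSum k A (λ w → uniq w * F w) ≡ arr k A F
wordSum-arr zero    A F u = ℕP.*-identityˡ (F [])
wordSum-arr (suc k) A F u = trans (∑≡sel _ A) (sel-cong A λ x r p → step x r p (Unique-resp-↭ (setoid ℕ) (↭⇒↭ₛ p) u))
  where
  step : ∀ x r → A ↭ x ∷ r → Unique (x ∷ r) →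
    wordSum k A (λ w → uniq (x ∷ w) * F (x ∷ w)) ≡ arr k r (λ w → F (x ∷ w))
  step x r p (x∉r ∷ ur) = begin
    wordSum k A (λ w → uniq (x ∷ w) * F (x ∷ w)) ≡⟨ wordSum-↭ k _ p ⟩
    wordSum k (x ∷ r) (λ w → uniq (x ∷ w) * F (x ∷ w))
      ≡⟨ wordSum-absent k x r _ (λ w x∈w → cong (_* F (x ∷ w)) (uniq-no (x ∷ w) λ { (h ∷ _) → All.lookup h x∈w refl })) ⟩
    wordSum k r (λ w → uniq (x ∷ w) * F (x ∷ w))
      ≡⟨ wordSum-cong k r x∉r (λ w h → cong (_* F (x ∷ w)) (uniq-∷ x w h)) ⟩
    wordSum k r (λ w → uniq w * F (x ∷ w)) ≡⟨ wordSum-arr k r _ ur ⟩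
    arr k r (λ w → F (x ∷ w)) ∎

unique-down : ∀ n → Unique (down n)
unique-down zero    = []
unique-down (suc n) = All.map (λ y< e → ℕP.<-irrefl (sym e) y<) (down< n) ∷ unique-down n

range↭down : ∀ n → range n ↭ down n
range↭down zero    = ↭-refl
range↭down (suc n) = ↭-trans (↭-reflexive (range-∷ʳ n))
  (↭-trans (↭-sym (∷↭∷ʳ (suc n) (range n))) (prep (suc n) (range↭down n)))

∑-Sn : ∀ n F → ∑ F (Sn n) ≡ arr n (down n) F
∑-Sn n F = begin
  ∑ F (filter unique? (words n n)) ≡⟨ ∑-filter unique? uniq F (words n n) uniq-yes uniq-no ⟩
  ∑ (λ w → uniq w * F w) (words n n) ≡⟨ ∑-words n n _ ⟩
  wordSum n (range n) (λ w → uniq w * F w) ≡⟨ wordSum-↭ n _ (range↭down n) ⟩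
  wordSum n (down n) (λ w → uniq w * F w) ≡⟨ wordSum-arr n (down n) F (unique-down n) ⟩
  arr n (down n) F ∎

-- Reading off the coefficients

eqn-refl : ∀ {a b} → a ≡ b → eqn a b ≡ 1
eqn-refl {zero}  refl = refl
eqn-refl {suc a} refl = eqn-refl {a} refl

eqn-≢ : ∀ a b → a ≢ b → eqn a b ≡ 0
eqn-≢ zero    zero    ne = contradiction refl ne
eqn-≢ zero    (suc b) ne = refl
eqn-≢ (suc a) zero    ne = refl
eqn-≢ (suc a) (suc b) ne = eqn-≢ a b λ e → ne (cong suc e)

eqn≤1 : ∀ a b → eqn a b ≤ 1
eqn≤1 zero    zero    = s≤s z≤n
eqn≤1 zero    (suc b) = z≤n
eqn≤1 (suc a) zero    = z≤n
eqn≤1 (suc a) (suc b) = eqn≤1 a b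

-- A polynomial with nonnegative coefficients smaller than q is determined by its value at q.
digits-unique : ∀ {A : Set} (L : List A) (c c' g g' : A → ℕ) →
  (∀ x → c x ≤ 1) → (∀ x → c' x ≤ 1) →
  ∑ (λ x → c x * suc (length L) ^ g x) L ≡ ∑ (λ x → c' x * suc (length L) ^ g' x) L →
  ∀ b → ∑ (λ x → c x * eqn (g x) b) L ≡ ∑ (λ x → c' x * eqn (g' x) b) L
digits-unique {A} L c c' g g' c≤ c'≤ eq b = go b c c' g g' c≤ c'≤ eq
  where
  q = suc (length L)
  const-part higher : (A → ℕ) → (A → ℕ) → ℕ
  const-part c g = ∑ (λ x → c x * eqn (g x) 0) L
  higher c g     = ∑ (λ x → c x * lt 0 (g x) * q ^ pred (g x)) L

  split : ∀ c g → ∑ (λ x → c x * q ^ g x) L ≡ const-part c g + higher c g * q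
  split c g = begin
    ∑ (λ x → c x * q ^ g x) L ≡⟨ ∑-cong L (λ x → pointwise (c x) (g x)) ⟩
    ∑ (λ x → c x * eqn (g x) 0 + q * (c x * lt 0 (g x) * q ^ pred (g x))) L ≡⟨ ∑-+ _ _ L ⟩
    const-part c g + ∑ (λ x → q * (c x * lt 0 (g x) * q ^ pred (g x))) L
      ≡⟨ cong (const-part c g +_) (trans (∑-*ˡ q _ L) (ℕP.*-comm q _)) ⟩
    const-part c g + higher c g * q ∎
    where
    pointwise : ∀ c g → c * q ^ g ≡ c * eqn g 0 + q * (c * lt 0 g * q ^ pred g)
    pointwise c zero    = lem c q
      where
      lem : ∀ c q → c * 1 ≡ c * 1 + q * (c * 0 * 1)
      lem = solve-∀
    pointwise c (suc g) = lem c q (q ^ g)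
      where
      lem : ∀ c q p → c * (q * p) ≡ c * 0 + q * (c * 1 * p)
      lem = solve-∀

  lt≤1 : ∀ a b → lt a b ≤ 1
  lt≤1 a       zero    = z≤n
  lt≤1 zero    (suc b) = s≤s z≤n
  lt≤1 (suc a) (suc b) = lt≤1 a b

  const-part< : ∀ c g → (∀ x → c x ≤ 1) → const-part c g < q
  const-part< c g c≤ = s≤s (bound L)
    where
    bound : ∀ L → ∑ (λ x → c x * eqn (g x) 0) L ≤ length L
    bound []      = z≤n
    bound (x ∷ L) = ℕP.+-mono-≤ (ℕP.*-mono-≤ (c≤ x) (eqn≤1 (g x) 0)) (bound L)

  -- The coefficients stay general: removing the constant term and dividing by q multiplies them by
  -- `lt 0 (g x)`, which drops the terms already counted.
  go : ∀ b (c c' g g' : A → ℕ) → (∀ x → c x ≤ 1) → (∀ x → c' x ≤ 1) →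
    ∑ (λ x → c x * q ^ g x) L ≡ ∑ (λ x → c' x * q ^ g' x) L →
    ∑ (λ x → c x * eqn (g x) b) L ≡ ∑ (λ x → c' x * eqn (g' x) b) L
  go b c c' g g' c≤ c'≤ eq = next b
    where
    eq' : const-part c g + higher c g * q ≡ const-part c' g' + higher c' g' * q
    eq' = trans (sym (split c g)) (trans eq (split c' g'))

    const≡ : const-part c g ≡ const-part c' g'
    const≡ = begin
      const-part c g ≡⟨ m<n⇒m%n≡m (const-part< c g c≤) ⟨
      const-part c g % q ≡⟨ [m+kn]%n≡m%n (const-part c g) (higher c g) q ⟨
      (const-part c g + higher c g * q) % q ≡⟨ cong (_% q) eq' ⟩
      (const-part c' g' + higher c' g' * q) % q ≡⟨ [m+kn]%n≡m%n (const-part c' g') (higher c' g') q ⟩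
      const-part c' g' % q ≡⟨ m<n⇒m%n≡m (const-part< c' g' c'≤) ⟩
      const-part c' g' ∎

    higher≡ : higher c g ≡ higher c' g'
    higher≡ = ℕP.*-cancelʳ-≡ _ _ q (ℕP.+-cancelˡ-≡ (const-part c g) _ _
      (trans eq' (cong (_+ higher c' g' * q) (sym const≡))))

    lower : ∀ b c g → c * eqn g (suc b) ≡ c * lt 0 g * eqn (pred g) b
    lower b c zero    = trans (ℕP.*-zeroʳ c) (cong (_* eqn 0 b) (sym (ℕP.*-zeroʳ c)))
    lower b c (suc g) = cong (_* eqn g b) (sym (ℕP.*-identityʳ c))

    next : ∀ b → ∑ (λ x → c x * eqn (g x) b) L ≡ ∑ (λ x → c' x * eqn (g' x) b) L
    next zero    = const≡
    next (suc b) = trans (∑-cong L λ x → lower b (c x) (g x)) (trans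
      (go b (λ x → c x * lt 0 (g x)) (λ x → c' x * lt 0 (g' x)) (λ x → pred (g x)) (λ x → pred (g' x))
        (λ x → ℕP.*-mono-≤ (c≤ x) (lt≤1 0 (g x))) (λ x → ℕP.*-mono-≤ (c'≤ x) (lt≤1 0 (g' x))) higher≡)
      (∑-cong L λ x → sym (lower b (c' x) (g' x))))

jointCount-∑ : ∀ f g n a b → jointCount f g n a b ≡ ∑ (λ σ → eqn (f σ) a * eqn (g σ) b) (Sn n)
jointCount-∑ f g n a b = length-filter-∑ _ _ (Sn n)
  (λ σ (p , p') → cong₂ _*_ (eqn-refl p) (eqn-refl p')) out
  where
  out : ∀ σ → ¬ (f σ ≡ a × g σ ≡ b) → eqn (f σ) a * eqn (g σ) b ≡ 0
  out σ np with f σ ℕP.≟ a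
  ... | no ne = cong (_* eqn (g σ) b) (eqn-≢ (f σ) a ne)
  ... | yes e = trans (cong (eqn (f σ) a *_) (eqn-≢ (g σ) b λ e' → np (e , e'))) (ℕP.*-zeroʳ (eqn (f σ) a))

generating-functions : ∀ q s n φ →
  ∑ (λ σ → φ (exc (suc s) σ) * q ^ den σ) (Sn n) ≡ ∑ (λ σ → φ (rdes (suc s) σ) * q ^ rmaj (suc s) σ) (Sn n)
generating-functions q s n φ = begin
  ∑ (λ σ → φ (exc (suc s) σ) * q ^ den σ) (Sn n) ≡⟨ ∑-Sn n _ ⟩
  -- `denSum` builds words from the last position on, so the sum is transported along reversal.
  arr n (down n) (λ σ → φ (exc (suc s) σ) * q ^ den σ) ≡⟨ arr-reverse n (down n) _ (length-down n) ⟨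
  arr n (down n) (λ τ → φ (exc (suc s) (reverse τ)) * q ^ den (reverse τ))
    ≡⟨ arr-cong n (down n) (length-down n) (λ τ p → cong₂ (λ u v → φ u * q ^ v)
        (exc-reverse s τ) (trans (den-reverse τ) (rden≡code n τ p))) ⟩
  denSum q s n (down n) φ ≡⟨ denSum≡rmajSum q s n φ ⟩
  rmajSum q s n φ
    ≡⟨ arr-ext n (down n) (λ w → cong₂ (λ u v → φ u * q ^ v) (rdes≡des (suc s) w) (rmaj≡maj (suc s) w)) ⟨
  arr n (down n) (λ σ → φ (rdes (suc s) σ) * q ^ rmaj (suc s) σ) ≡⟨ ∑-Sn n _ ⟨
  ∑ (λ σ → φ (rdes (suc s) σ) * q ^ rmaj (suc s) σ) (Sn n) ∎

theorem1p3 : (r : ℕ) → 1 ≤ r → (n : ℕ) → 1 ≤ n → (a b : ℕ) →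
    jointCount (exc r) den n a b ≡ jointCount (rdes r) (rmaj r) n a b
theorem1p3 (suc s) _ n _ a b = begin
  jointCount (exc (suc s)) den n a b ≡⟨ jointCount-∑ (exc (suc s)) den n a b ⟩
  ∑ (λ σ → eqn (exc (suc s) σ) a * eqn (den σ) b) (Sn n)
    ≡⟨ digits-unique (Sn n) _ _ den (rmaj (suc s))
        (λ σ → eqn≤1 (exc (suc s) σ) a) (λ σ → eqn≤1 (rdes (suc s) σ) a)
        -- The weight φ is the indicator of a, which isolates the coefficient of t ^ a.
        (generating-functions (suc (length (Sn n))) s n (λ k → eqn k a)) b ⟩
  ∑ (λ σ → eqn (rdes (suc s) σ) a * eqn (rmaj (suc s) σ) b) (Sn n) ≡⟨ jointCount-∑ (rdes (suc s)) (rmaj (suc s)) n a b ⟨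
  jointCount (rdes (suc s)) (rmaj (suc s)) n a b ∎
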